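{- For every $n\ge1$ and every partition $\lambda\vdash n$, $$|\phi(\lambda)|=\#\{w\in\mathfrak{A}_{2n}:\mathrm{rp}(\hat w)=\lambda\}.$$
   Context: For $\lambda=\langle 1^{m_1},\dots,n^{m_n}\rangle\vdash n$ ($m_k$ parts equal to $k$), $\phi(\lambda)=(2n)!\prod_{k=1}^n\frac{1}{m_k!}\left(\frac{4^k(4^k-1)B_{2k}}{(2k)(2k)!}\right)^{m_k}$, where $B_{2k}$ are Bernoulli numbers. A permutation $w=a_1a_2\cdots a_k\in\mathfrak{S}_k$ is alternating if $a_1>a_2<a_3>a_4<\cdots$; $\mathfrak{A}_k$ is the set of alternating permutations in $\mathfrak{S}_k$. For $w=a_1\cdots a_{2n}\in\mathfrak{A}_{2n}$, let $\hat w=b_1b_2\cdots b_n$ with $b_i=a_{2i-1}$. The record set $\mathrm{rec}(\hat w)$ is the set of $i\in[n]$ such that $b_i>b_j$ for all $1\le j<i$ (so $1\in\mathrm{rec}(\hat w)$). If $\mathrm{rec}(\hat w)=\{r_1<r_2<\cdots<r_j\}$, the record partition $\mathrm{rp}(\hat w)\vdash n$ is the partition with parts $r_2-r_1,r_3-r_2,\dots,r_j-r_{j-1},n+1-r_j$ arranged in weakly decreasing order. -}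

module Defs where

open import Data.Bool using (Bool; true; false; _∧_; not; if_then_else_)
open import Data.Nat as ℕ using (ℕ; zero; suc; _∸_; _≡ᵇ_; _<ᵇ_; _≥_)
open import Data.Nat.Combinatorics using (_C_)
open import Data.Nat.Base using (_!)
open import Data.Integer using (+_)
open import Data.Rational using (ℚ; _/_; _+_; _*_; -_; 0ℚ; 1ℚ)
open import Data.List using (List; []; _∷_; [_]; map; concatMap; upTo; foldr; filterᵇ; length;  zip; _++_)
open import Data.Nat.ListAction using (sum)
open import Data.Bool.ListAction using (any)
open import Data.List.Properties using (≡-dec)
open import Data.List.Relation.Unary.All using (All)
open import Data.List.Relation.Unary.Linked using (Linked)
open import Data.Product using (_×_; proj₁; proj₂)
open import Relation.Binary.PropositionalEquality using (_≡_)
open import Relation.Nullary.Decidable using (⌊_⌋)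

-- 1/d as a rational (only ever applied to nonzero d below; invℕ 0 = 0)
invℕ : ℕ → ℚ
invℕ zero    = 0ℚ
invℕ (suc d) = (+ 1) / suc d

fromℕ : ℕ → ℚ
fromℕ k = (+ k) / 1

_^Q_ : ℚ → ℕ → ℚ
x ^Q zero  = 1ℚ
x ^Q suc k = x * (x ^Q k)

sumQ : List ℚ → ℚ
sumQ = foldr _+_ 0ℚ

prodQ : List ℚ → ℚ
prodQ = foldr _*_ 1ℚ

-- Bernoulli numbers B_0, B_1, ... via the standard recurrence
--   B_0 = 1,   Σ_{j=0}^{m} C(m+1, j) B_j = 0  for m ≥ 1
-- i.e. B_m = - 1/(m+1) Σ_{j<m} C(m+1,j) B_j   (so B_1 = -1/2).

bernList : ℕ → List ℚ
bernList zero    = 1ℚ ∷ []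
bernList (suc m) = bs ++ [ - (invℕ (suc (suc m)) * sumQ (map term (zip (upTo (suc m)) bs))) ]
  where
  bs : List ℚ
  bs = bernList m
  term : ℕ × ℚ → ℚ
  term p = fromℕ (suc (suc m) C proj₁ p) * proj₂ p

lastQ : List ℚ → ℚ
lastQ []           = 0ℚ
lastQ (x ∷ [])     = x
lastQ (x ∷ y ∷ xs) = lastQ (y ∷ xs)

bernoulli : ℕ → ℚ
bernoulli m = lastQ (bernList m)

mult : ℕ → List ℕ → ℕ
mult k ls = length (filterᵇ (λ x → x ≡ᵇ k) ls)

coeff : ℕ → ℚ
coeff k = fromℕ (4 ℕ.^ k) * fromℕ (4 ℕ.^ k ∸ 1) * bernoulli (2 ℕ.* k)
          * invℕ ((2 ℕ.* k) ℕ.* (2 ℕ.* k) !)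

phi : (n : ℕ) → List ℕ → ℚ
phi n ls = fromℕ ((2 ℕ.* n) !) * prodQ (map factor (map suc (upTo n)))
  where
  factor : ℕ → ℚ
  factor k = invℕ (mult k ls !) * (coeff k ^Q mult k ls)

IsPartition : ℕ → List ℕ → Set
IsPartition n ls = Linked _≥_ ls × All (λ x → x ≥ 1) ls × sum ls ≡ n

-- Words / permutations.  A permutation of [2n] is encoded as its one-line
-- word a_1 ... a_{2n} with letters in {0, ..., 2n-1} (order-isomorphic to
-- {1, ..., 2n}); words of length m over {0..m-1} with distinct letters are
-- exactly the permutations.

words : ℕ → ℕ → List (List ℕ)
words zero    m = [ [] ]
words (suc k) m = concatMap (λ a → map (a ∷_) (words k m)) (upTo m)

distinct : List ℕ → Bool
distinct []       = true
distinct (x ∷ xs) = not (any (λ y → x ≡ᵇ y) xs) ∧ distinct xs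

mutual
  altDown : List ℕ → Bool
  altDown (x ∷ y ∷ r) = (y <ᵇ x) ∧ altUp (y ∷ r)
  altDown _           = true

  altUp : List ℕ → Bool
  altUp (x ∷ y ∷ r) = (x <ᵇ y) ∧ altDown (y ∷ r)
  altUp _           = true

isAlternatingPerm : ℕ → List ℕ → Bool
isAlternatingPerm m w = ⌊ length w ℕ.≟ m ⌋ ∧ distinct w ∧ altDown w

hat : List ℕ → List ℕ
hat (x ∷ y ∷ r) = x ∷ hat r
hat (x ∷ [])    = x ∷ []
hat []          = []

data MaybeN : Set where
  none : MaybeN
  some : ℕ → MaybeN

recordsFrom : ℕ → MaybeN → List ℕ → List ℕ
recordsFrom i none     (b ∷ bs) = i ∷ recordsFrom (suc i) (some b) bs
recordsFrom i (some m) (b ∷ bs) =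
  if m <ᵇ b then i ∷ recordsFrom (suc i) (some b) bs
            else recordsFrom (suc i) (some m) bs
recordsFrom i _        []       = []

rec : List ℕ → List ℕ
rec b = recordsFrom 1 none b

gaps : ℕ → List ℕ → List ℕ
gaps n (r ∷ s ∷ rs) = (s ∸ r) ∷ gaps n (s ∷ rs)
gaps n (r ∷ [])     = (suc n ∸ r) ∷ []
gaps n []           = []

insertDesc : ℕ → List ℕ → List ℕ
insertDesc x []       = x ∷ []
insertDesc x (y ∷ ys) = if y <ᵇ x then x ∷ y ∷ ys else y ∷ insertDesc x ys

sortDesc : List ℕ → List ℕ
sortDesc = foldr insertDesc []

rp : ℕ → List ℕ → List ℕ
rp n b = sortDesc (gaps n (rec b))

countRP : ℕ → List ℕ → ℕ
countRP n ls = length (filterᵇ (λ w → isAlternatingPerm (2 ℕ.* n) w ∧ ⌊ ≡-dec ℕ._≟_ (rp n (hat w)) ls ⌋)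
                              (words (2 ℕ.* n) (2 ℕ.* n)))

{-# OPTIONS --safe #-}

-- Cutting an alternating word w at its maximum M writes it as u M v with u alternating of
-- even length and v up-down of odd length, and the gaps between records of w are those of u
-- followed by (|v| + 1)/2.  Let e(k) be the number of up-down words of length k.  If equal
-- parts of λ ⊢ n are distinguished, the exponential generating functions of the words with
-- record partition λ satisfy
--   G_λ′ = Σ_{c ∈ λ} G_{λ ∖ c} · e(2c-1) x^{2c-1}/(2c-1)!,
-- which is solved by G_λ = x^{2n} ∏_{c ∈ λ} e(2c-1)/(2c)! because Σ_{c ∈ λ} 2c = 2n.
--
-- The same cut applied to up-down words gives y′ = 1 + y² for the odd part of e.  With
-- alternating signs this becomes t′ = 1 - t², so t (e^{2x} + 1) = e^{2x} - 1 and hence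
-- x t = x - b(2x) + b(4x) for b = x/(e^x - 1).  Comparing coefficients,
-- 2k e(2k-1) = |4^k (4^k - 1) B_{2k}|.

module Submission where

open import Defs
open import Algebra.Bundles using (CommutativeSemiring)
import Algebra.Solver.Ring.NaturalCoefficients.Default as SemiringSolver
open import Algebra.Structures using (IsCommutativeRing; IsCommutativeSemiring)
open import Data.Bool using (Bool; true; false; _∧_; _∨_; not; T; T?)
open import Data.Bool.ListAction using (any)
open import Data.Bool.Properties using (T-≡)
open import Data.List using
  (List; []; _∷_; [_]; map; concatMap; upTo; downFrom; length; _++_; filterᵇ; reverse; zip)
open import Data.List.Membership.Propositional using (_∈_)
open import Data.List.Membership.Propositional.Properties using (∈-downFrom⁻; ∈-map⁺; ∈-upTo⁺)
open import Data.List.Properties using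
  (≡-dec; length-++; length-downFrom; map-++; map-upTo; reverse-++; reverse-upTo; upTo-∷ʳ)
open import Data.List.Relation.Binary.Permutation.Propositional using
  (_↭_; prep; swap; ↭-refl; ↭-reflexive; ↭-sym; ↭-trans; ↭⇒↭ₛ)
open import Data.List.Relation.Binary.Permutation.Propositional.Properties using
  (All-resp-↭; drop-∷; filter-↭; ↭-empty-inv; ↭-length; ↭-reverse)
import Data.List.Relation.Binary.Permutation.Setoid.Properties as Permutation
open import Data.List.Relation.Binary.Pointwise using (Pointwise-≡⇒≡)
open import Data.List.Relation.Binary.Sublist.Propositional using (_⊆_; []; _∷_; _∷ʳ_)
open import Data.List.Relation.Binary.Sublist.Propositional.Properties using (All-resp-⊆; length-mono-≤)
open import Data.List.Relation.Unary.All as All using (All; []; _∷_)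
open import Data.List.Relation.Unary.AllPairs using (AllPairs; []; _∷_)
open import Data.List.Relation.Unary.AllPairs.Properties using (applyDownFrom⁺₁)
open import Data.List.Relation.Unary.Any using (here; there)
open import Data.List.Relation.Unary.Linked using (Linked)
open import Data.List.Relation.Unary.Linked.Properties using (AllPairs⇒Linked)
open import Data.List.Relation.Unary.Sorted.TotalOrder.Properties using (↗↭↗⇒≋)
open import Data.List.Relation.Unary.Unique.Propositional using (Unique)
open import Data.List.Relation.Unary.Unique.Propositional.Properties using (map⁺; upTo⁺; downFrom⁺)
open import Data.Nat as ℕ using
  (ℕ; zero; suc; pred; _∸_; _!; _≡ᵇ_; _<ᵇ_; _<_; _>_; _≤_; _≥_; z≤n; s≤s; ⌊_/2⌋)
open import Data.Nat.Combinatorics using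
  (_C_; k>n⇒nCk≡0; nC1≡n; nCk+nC[k+1]≡[n+1]C[k+1]; nCk≡nC[n∸k]; nCn≡1)
open import Data.Nat.ListAction using (sum)
open import Data.Nat.ListAction.Properties using (sum-↭)
import Data.Nat.Properties as ℕ
open import Data.Product using (_×_; _,_; proj₁; proj₂)
open import Data.Rational using (ℚ; 0ℚ; 1ℚ; ∣_∣)
open import Data.Sum using (inj₁; inj₂)
open import Data.Unit using (tt)
open import Function using (_∘_; id)
open import Function.Bundles using (Equivalence)
open import Level using (0ℓ)
import Relation.Binary.Construct.Flip.EqAndOrd as Flip
open import Relation.Binary.PropositionalEquality hiding ([_])
open import Relation.Nullary using (¬_; yes; no; contradiction)
open import Relation.Nullary.Decidable using (⌊_⌋)

-- Alternating words and their records

-- Distinguishing equal parts makes the removal of a part a plain sum over the entries of `ps`; the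
-- labels cost a factor ∏ mₖ!, which φ divides out again.
--
-- The cut leaves u and v on arbitrary complementary sets of letters, so the counts are established
-- for all descending alphabets and shown to depend on their length only.
--
-- Counting takes place in a commutative semiring: identities with a minus sign have their negative
-- terms moved to the other side, and e(2c-1)/(2c)! enters as an element x(c) with x(c) (2c)! =
-- e(2c-1).
--
-- The formula for x t is the partial fraction 1/(y + 1) = 1/(y - 1) - 2/(y² - 1) at y = e^(2x),
-- since t = 1 - 2/(y + 1). It is obtained by cancelling y² - 1 = e^(4x) - 1, which has no constant
-- term and so is not a unit; the cancellation rests on its linear coefficient 4.

≡ᵇ-refl : ∀ n → (n ≡ᵇ n) ≡ true
≡ᵇ-refl zero    = refl
≡ᵇ-refl (suc n) = ≡ᵇ-refl n

≢⇒≡ᵇ-false : ∀ {m n} → m ≢ n → (m ≡ᵇ n) ≡ false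
≢⇒≡ᵇ-false {m} {n} m≢n with m ≡ᵇ n in eq
... | false = refl
... | true  = contradiction (ℕ.≡ᵇ⇒≡ m n (subst Data.Bool.T (sym eq) _)) m≢n

mutual
  even odd : ℕ → Bool
  even zero    = true
  even (suc n) = odd n

  odd zero    = false
  odd (suc n) = even n

<⇒<ᵇ-true : ∀ {m n} → m < n → (m <ᵇ n) ≡ true
<⇒<ᵇ-true p = Equivalence.to T-≡ (ℕ.<⇒<ᵇ p)

<⇒>ᵇ-false : ∀ {m n} → m < n → (n <ᵇ m) ≡ false
<⇒>ᵇ-false {m} {n} p with n <ᵇ m in eq
... | false = refl
... | true  = contradiction (ℕ.<ᵇ⇒< n m (Equivalence.from T-≡ eq)) (ℕ.<-asym p)

altUp-below : ∀ {M} v → All (_< M) v → altDown (M ∷ v) ≡ altUp v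
altUp-below []      _         = refl
altUp-below (y ∷ v) (y<M ∷ _) rewrite <⇒<ᵇ-true y<M = refl

mutual
  -- An entry above all others can only be a peak, and the peaks of a down-up word have an even
  -- number of letters before them. The descent from `M` to `v` is automatic.
  altDown-pivot : ∀ {M} u v → All (_< M) u → All (_< M) v →
    altDown (u ++ M ∷ v) ≡ even (length u) ∧ altDown u ∧ altUp v
  altDown-pivot []          v _              v<M = altUp-below v v<M
  altDown-pivot (x ∷ [])    v (x<M ∷ _)      v<M rewrite <⇒>ᵇ-false x<M = refl
  altDown-pivot (x ∷ y ∷ u) v (_ ∷ yu<M)     v<M rewrite altUp-pivot y u v yu<M v<M
    with y <ᵇ x | odd (length (y ∷ u))
  ... | true  | _     = refl
  ... | false | true  = refl
  ... | false | false = refl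

  altUp-pivot : ∀ {M} x u v → All (_< M) (x ∷ u) → All (_< M) v →
    altUp (x ∷ u ++ M ∷ v) ≡ odd (length (x ∷ u)) ∧ altUp (x ∷ u) ∧ altUp v
  altUp-pivot x []      v (x<M ∷ _)    v<M rewrite <⇒<ᵇ-true x<M = altUp-below v v<M
  altUp-pivot x (y ∷ u) v (_ ∷ yu<M)   v<M rewrite altDown-pivot (y ∷ u) v yu<M v<M
    with x <ᵇ y | even (length (y ∷ u))
  ... | true  | _     = refl
  ... | false | true  = refl
  ... | false | false = refl

recordsFrom-[] : ∀ {M} i b → All (_< M) b → recordsFrom i (some M) b ≡ []
recordsFrom-[] i []      _           = refl
recordsFrom-[] i (x ∷ b) (x<M ∷ b<M) rewrite <⇒>ᵇ-false x<M = recordsFrom-[] (suc i) b b<M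

recordsFrom-max : ∀ i m {M} b b′ → All (_< M) b → All (_< M) b′ → m < M →
  recordsFrom i (some m) (b ++ M ∷ b′) ≡ recordsFrom i (some m) b ++ [ i ℕ.+ length b ]
recordsFrom-max i m [] b′ _ b′<M m<M rewrite <⇒<ᵇ-true m<M | ℕ.+-identityʳ i = cong (i ∷_)
    (recordsFrom-[] (suc i) b′ b′<M)
recordsFrom-max i m (x ∷ b) b′ (x<M ∷ b<M) b′<M m<M rewrite ℕ.+-suc i (length b) with m <ᵇ x
... | true  = cong (i ∷_) (recordsFrom-max (suc i) x b b′ b<M b′<M x<M)
... | false = recordsFrom-max (suc i) m b b′ b<M b′<M m<M

rec-max : ∀ {M} b b′ → All (_< M) b → All (_< M) b′ → rec (b ++ M ∷ b′) ≡ rec b ++ [ suc (length b) ]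
rec-max []      b′ _ b′<M = cong (1 ∷_) (recordsFrom-[] 2 b′ b′<M)
rec-max (x ∷ b) b′ (x<M ∷ b<M) b′<M = cong (1 ∷_) (recordsFrom-max 2 x b b′ b<M b′<M x<M)

-- A record at position `suc p` has `p` entries before it. The gap leading to it, `suc p ∸ r`, is
-- the closing gap that `gaps p` assigns to the prefix, and the new closing gap is `suc n ∸ suc p`.
gaps-∷ʳ : ∀ n rs p → gaps n (rs ++ [ suc p ]) ≡ gaps p rs ++ [ n ∸ p ]
gaps-∷ʳ n []           p = refl
gaps-∷ʳ n (r ∷ [])     p = refl
gaps-∷ʳ n (r ∷ s ∷ rs) p = cong (s ∸ r ∷_) (gaps-∷ʳ n (s ∷ rs) p)

-- Half the length stands in for the n of `gaps`, so that the same function measures a word and its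
-- prefix before the maximum.
gapsOf : List ℕ → List ℕ
gapsOf w = gaps ⌊ length w /2⌋ (rec (hat w))

hat-++ : ∀ u (v : List ℕ) → even (length u) ≡ true → hat (u ++ v) ≡ hat u ++ hat v
hat-++ []          v _ = refl
hat-++ (x ∷ y ∷ u) v e = cong (x ∷_) (hat-++ u v e)

All-hat : ∀ {P : ℕ → Set} {w} → All P w → All P (hat w)
All-hat []             = []
All-hat (px ∷ [])      = px ∷ []
All-hat (px ∷ _ ∷ pw)  = px ∷ All-hat pw

length-hat : ∀ w → even (length w) ≡ true → length (hat w) ≡ ⌊ length w /2⌋
length-hat []          _ = refl
length-hat (x ∷ y ∷ w) e = cong suc (length-hat w e)

even-+ : ∀ m n → even m ≡ true → ⌊ m ℕ.+ n /2⌋ ≡ ⌊ m /2⌋ ℕ.+ ⌊ n /2⌋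
even-+ zero          n _ = refl
even-+ (suc (suc m)) n e = cong suc (even-+ m n e)

-- With an even number of letters before it, `M` is among the letters that `hat` keeps, and it is
-- then the last record.
gapsOf-pivot : ∀ {M} u v → All (_< M) u → All (_< M) v → even (length u) ≡ true →
  gapsOf (u ++ M ∷ v) ≡ gapsOf u ++ [ ⌊ suc (length v) /2⌋ ]
gapsOf-pivot {M} u v u<M v<M e = begin
  gaps ⌊ length (u ++ M ∷ v) /2⌋ (rec (hat (u ++ M ∷ v)))
    ≡⟨ cong₂ (λ l b → gaps ⌊ l /2⌋ (rec b)) (length-++ u) (hat-++ u (M ∷ v) e) ⟩
  gaps ⌊ length u ℕ.+ suc (length v) /2⌋ (rec (hat u ++ hat (M ∷ v)))
    ≡⟨ cong₂ gaps (even-+ (length u) (suc (length v)) e) (rec-hat v v<M) ⟩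
  gaps (⌊ length u /2⌋ ℕ.+ ⌊ suc (length v) /2⌋) (rec (hat u) ++ [ suc (length (hat u)) ])
    ≡⟨ gaps-∷ʳ _ (rec (hat u)) (length (hat u)) ⟩
  gaps (length (hat u)) (rec (hat u)) ++ [ (⌊ length u /2⌋ ℕ.+ ⌊ suc (length v) /2⌋) ∸ length (hat u) ]
    ≡⟨ cong (λ l → gaps l (rec (hat u)) ++ [ (⌊ length u /2⌋ ℕ.+ ⌊ suc (length v) /2⌋) ∸ l ]) (length-hat u e) ⟩
  gapsOf u ++ [ (⌊ length u /2⌋ ℕ.+ ⌊ suc (length v) /2⌋) ∸ ⌊ length u /2⌋ ]
    ≡⟨ cong (λ c → gapsOf u ++ [ c ]) (ℕ.m+n∸m≡n ⌊ length u /2⌋ _) ⟩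
  gapsOf u ++ [ ⌊ suc (length v) /2⌋ ] ∎
  where
  open ≡-Reasoning
  -- `hat` drops the letter after `M`, so `v` has to be split before `hat (M ∷ v)` reduces.
  rec-hat : ∀ v → All (_< M) v → rec (hat u ++ hat (M ∷ v)) ≡ rec (hat u) ++ [ suc (length (hat u)) ]
  rec-hat []      _          = rec-max (hat u) [] (All-hat u<M) []
  rec-hat (y ∷ v) (_ ∷ v<M)  = rec-max (hat u) (hat v) (All-hat u<M) (All-hat v<M)

-- The maximum of a descending alphabet is its head, and sublists are again descending, so the cut
-- at the maximum can be repeated on both sides.
Descending : List ℕ → Set
Descending = AllPairs _>_

descending-⊆ : ∀ {S V} → S ⊆ V → Descending V → Descending S
descending-⊆ []            []          = []
descending-⊆ (x ∷ʳ p)      (_ ∷ V↓)    = descending-⊆ p V↓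
descending-⊆ (refl ∷ p)  (x>V ∷ V↓)  = All-resp-⊆ p x>V ∷ descending-⊆ p V↓

descending-downFrom : ∀ n → Descending (downFrom n)
descending-downFrom n = applyDownFrom⁺₁ id n λ j<i _ → j<i

-- Parity, multiplicities and sorting

even-2* : ∀ s → even (2 ℕ.* s) ≡ true
even-2* zero    = refl
even-2* (suc s) rewrite ℕ.+-suc s (s ℕ.+ 0) = even-2* s

even-odd-+ : ∀ i j → even i ≡ true → odd (i ℕ.+ j) ≡ true → odd j ≡ true
even-odd-+ zero          j _ q = q
even-odd-+ (suc (suc i)) j p q = even-odd-+ i j p q

-- Recovers |v| = 2c - 1 from the part c = (|v| + 1)/2 that the cut creates.
⌊suc-odd/2⌋ : ∀ j → odd j ≡ true → pred (2 ℕ.* ⌊ suc j /2⌋) ≡ j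
⌊suc-odd/2⌋ (suc zero)    _ = refl
⌊suc-odd/2⌋ (suc (suc j)) p with ⌊ suc j /2⌋ | ⌊suc-odd/2⌋ j p
... | zero  | refl = contradiction p λ ()
... | suc k | eq rewrite ℕ.+-suc k (suc (k ℕ.+ 0)) = cong (suc ∘ suc) eq

mult-same : ∀ c g → mult c (c ∷ g) ≡ suc (mult c g)
mult-same c g rewrite ≡ᵇ-refl c = refl

mult-other : ∀ {c k} g → c ≢ k → mult k (c ∷ g) ≡ mult k g
mult-other g c≢k rewrite ≢⇒≡ᵇ-false c≢k = refl

mult-↭ : ∀ k {g h} → g ↭ h → mult k g ≡ mult k h
mult-↭ k p = ↭-length (filter-↭ (T? ∘ (_≡ᵇ k)) p)

insertDesc-↭ : ∀ x ys → insertDesc x ys ↭ x ∷ ys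
insertDesc-↭ x []       = ↭-refl
insertDesc-↭ x (y ∷ ys) with y <ᵇ x
... | true  = ↭-refl
... | false = ↭-trans (prep y (insertDesc-↭ x ys)) (swap y x ↭-refl)

sortDesc-↭ : ∀ g → sortDesc g ↭ g
sortDesc-↭ []      = ↭-refl
sortDesc-↭ (x ∷ g) = ↭-trans (insertDesc-↭ x (sortDesc g)) (prep x (sortDesc-↭ g))

insertDesc-sorted : ∀ x {ys} → AllPairs _≥_ ys → AllPairs _≥_ (insertDesc x ys)
insertDesc-sorted x {[]}     []         = [] ∷ []
insertDesc-sorted x {y ∷ ys} (y≥ys ∷ ys↓) with y <ᵇ x in eq
... | true  = (y≤x ∷ All.map (λ z≤y → ℕ.≤-trans z≤y y≤x) y≥ys) ∷ y≥ys ∷ ys↓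
  where y≤x = ℕ.<⇒≤ (ℕ.<ᵇ⇒< y x (subst Data.Bool.T (sym eq) tt))
... | false = All-resp-↭ (↭-sym (insertDesc-↭ x ys)) (x≤y ∷ y≥ys) ∷ insertDesc-sorted x ys↓
  where x≤y = ℕ.≮⇒≥ λ y<x → subst Data.Bool.T eq (ℕ.<⇒<ᵇ y<x)

sortDesc-sorted : ∀ g → AllPairs _≥_ (sortDesc g)
sortDesc-sorted []      = []
sortDesc-sorted (x ∷ g) = insertDesc-sorted x (sortDesc-sorted g)

↭⇒sortDesc≡ : ∀ {g ps} → Linked _≥_ ps → g ↭ ps → sortDesc g ≡ ps
↭⇒sortDesc≡ {g} ps↓ p = Pointwise-≡⇒≡ (↗↭↗⇒≋ (Flip.totalOrder ℕ.≤-totalOrder)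
  (AllPairs⇒Linked (sortDesc-sorted g)) ps↓ (↭⇒↭ₛ (↭-trans (sortDesc-↭ g) p)))

parts : ℕ → List ℕ
parts n = map suc (upTo n)

parts-unique : ∀ n → Unique (parts n)
parts-unique n = map⁺ ℕ.suc-injective (upTo⁺ n)

∈-parts : ∀ {n c} → c ≥ 1 → c ≤ n → c ∈ parts n
∈-parts {c = suc c} _ c<n = ∈-map⁺ suc (∈-upTo⁺ c<n)

partition-∈-parts : ∀ {n ps} → IsPartition n ps → All (_∈ parts n) ps
partition-∈-parts (_ , ps≥1 , refl) = go _ ps≥1 ℕ.≤-refl
  where
  go : ∀ {n} ps → All (_≥ 1) ps → sum ps ≤ n → All (_∈ parts n) ps
  go []       []           _  = []
  go (c ∷ ps) (c≥1 ∷ ps≥1) le = ∈-parts c≥1 (ℕ.≤-trans (ℕ.m≤m+n c _) le) ∷ go ps ps≥1 (ℕ.≤-trans (ℕ.m≤n+m _ c) le)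

⌊2*/2⌋ : ∀ n → ⌊ 2 ℕ.* n /2⌋ ≡ n
⌊2*/2⌋ n = trans (cong (λ k → ⌊ n ℕ.+ k /2⌋) (ℕ.+-identityʳ n)) (sym (ℕ.n≡⌊n+n/2⌋ n))

-- Counting with values in a commutative semiring

module Counting {A : Set} {_✚_ _✖_ : A → A → A} {0# 1# : A}
  (isCommutativeSemiring : IsCommutativeSemiring _≡_ _✚_ _✖_ 0# 1#) where

  open IsCommutativeSemiring isCommutativeSemiring using
    ( +-assoc; +-comm; +-identityˡ; +-identityʳ; *-assoc; *-comm; *-identityˡ; *-identityʳ
    ; zeroˡ; zeroʳ; distribˡ; distribʳ )
  open ≡-Reasoning

  infixl 6 _+_
  infixl 7 _*_
  _+_ _*_ : A → A → A
  _+_ = _✚_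
  _*_ = _✖_

  semiring : CommutativeSemiring 0ℓ 0ℓ
  semiring = record { isCommutativeSemiring = isCommutativeSemiring }

  module A-Solver = SemiringSolver semiring
  open A-Solver using (solve; _:=_; _:+_; _:*_)

  ι : ℕ → A
  ι zero    = 0#
  ι (suc n) = 1# + ι n

  ι-+ : ∀ m n → ι (m ℕ.+ n) ≡ ι m + ι n
  ι-+ zero    n = sym (+-identityˡ (ι n))
  ι-+ (suc m) n = trans (cong (1# +_) (ι-+ m n)) (sym (+-assoc 1# (ι m) (ι n)))

  ι-* : ∀ m n → ι (m ℕ.* n) ≡ ι m * ι n
  ι-* zero    n = sym (zeroˡ (ι n))
  ι-* (suc m) n = begin
    ι (n ℕ.+ m ℕ.* n)        ≡⟨ ι-+ n (m ℕ.* n) ⟩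
    ι n + ι (m ℕ.* n)        ≡⟨ cong₂ _+_ (sym (*-identityˡ (ι n))) (ι-* m n) ⟩
    1# * ι n + ι m * ι n     ≡⟨ distribʳ (ι n) 1# (ι m) ⟨
    (1# + ι m) * ι n         ∎

  ⟦_⟧ : Bool → A
  ⟦ true  ⟧ = 1#
  ⟦ false ⟧ = 0#

  ⟦⟧-∧ : ∀ a b → ⟦ a ∧ b ⟧ ≡ ⟦ a ⟧ * ⟦ b ⟧
  ⟦⟧-∧ true  b = sym (*-identityˡ ⟦ b ⟧)
  ⟦⟧-∧ false b = sym (zeroˡ ⟦ b ⟧)

  +-interchange : ∀ a b c d → (a + b) + (c + d) ≡ (a + c) + (b + d)
  +-interchange = solve 4 (λ a b c d → (a :+ b) :+ (c :+ d) := (a :+ c) :+ (b :+ d)) refl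

  *-interchange : ∀ a b c d → (a * b) * (c * d) ≡ (a * c) * (b * d)
  *-interchange = solve 4 (λ a b c d → (a :* b) :* (c :* d) := (a :* c) :* (b :* d)) refl

  -- Exponential generating functions

  Series : Set
  Series = ℕ → A

  private variable
    f f′ g g′ : Series
    B D : Set

  -- shuffle h n = Σ_{i+j=n} C(n,i) h(i,j); the recursion is Pascal's rule.
  shuffle : (ℕ → ℕ → A) → ℕ → A
  shuffle h zero    = h 0 0
  shuffle h (suc n) = shuffle (λ i j → h (suc i) j) n + shuffle (λ i j → h i (suc j)) n

  -- f : Series stands for Σ f(n) xⁿ/n!, so that f ∘ suc is the derivative and the
  -- defining recursion of the product is the Leibniz rule.
  infixl 7 _⊛_
  _⊛_ : Series → Series → Series
  f ⊛ g = shuffle (λ i j → f i * g j)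

  infixl 6 _⊕_
  _⊕_ : Series → Series → Series
  (f ⊕ g) n = f n + g n

  0ₛ 1ₛ : Series
  0ₛ _ = 0#
  1ₛ zero    = 1#
  1ₛ (suc _) = 0#

  shuffle-cong : ∀ {h k : ℕ → ℕ → A} n → (∀ i j → i ℕ.+ j ≡ n → h i j ≡ k i j) → shuffle h n ≡ shuffle k n
  shuffle-cong zero    eq = eq 0 0 refl
  shuffle-cong (suc n) eq = cong₂ _+_
    (shuffle-cong n λ i j p → eq (suc i) j (cong suc p))
    (shuffle-cong n λ i j p → eq i (suc j) (trans (ℕ.+-suc i j) (cong suc p)))

  shuffle-+ : ∀ (h k : ℕ → ℕ → A) n → shuffle (λ i j → h i j + k i j) n ≡ shuffle h n + shuffle k n
  shuffle-+ h k zero    = refl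
  shuffle-+ h k (suc n) = trans (cong₂ _+_ (shuffle-+ _ _ n) (shuffle-+ _ _ n)) (+-interchange _ _ _ _)

  shuffle-* : ∀ c (h : ℕ → ℕ → A) n → shuffle (λ i j → c * h i j) n ≡ c * shuffle h n
  shuffle-* c h zero    = refl
  shuffle-* c h (suc n) = trans (cong₂ _+_ (shuffle-* c _ n) (shuffle-* c _ n)) (sym (distribˡ c _ _))

  shuffle-0 : ∀ n → shuffle (λ _ _ → 0#) n ≡ 0#
  shuffle-0 zero    = refl
  shuffle-0 (suc n) = trans (cong₂ _+_ (shuffle-0 n) (shuffle-0 n)) (+-identityˡ 0#)

  ⊛-cong : f ≗ f′ → g ≗ g′ → f ⊛ g ≗ f′ ⊛ g′
  ⊛-cong p q n = shuffle-cong n λ i j _ → cong₂ _*_ (p i) (q j)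

  ⊛-comm : ∀ f g → f ⊛ g ≗ g ⊛ f
  ⊛-comm f g zero    = *-comm (f 0) (g 0)
  ⊛-comm f g (suc n) = trans (cong₂ _+_ (⊛-comm (f ∘ suc) g n) (⊛-comm f (g ∘ suc) n)) (+-comm _ _)

  ⊛-distribʳ : ∀ h f g → (f ⊕ g) ⊛ h ≗ (f ⊛ h) ⊕ (g ⊛ h)
  ⊛-distribʳ h f g n = trans (shuffle-cong n λ i j _ → distribʳ (h j) (f i) (g i)) (shuffle-+ _ _ n)

  ⊛-distribˡ : ∀ h f g → h ⊛ (f ⊕ g) ≗ (h ⊛ f) ⊕ (h ⊛ g)
  ⊛-distribˡ h f g n = trans (shuffle-cong n λ i j _ → distribˡ (h i) (f j) (g j)) (shuffle-+ _ _ n)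

  ⊛-assoc : ∀ f g h → (f ⊛ g) ⊛ h ≗ f ⊛ (g ⊛ h)
  ⊛-assoc f g h zero    = *-assoc (f 0) (g 0) (h 0)
  ⊛-assoc f g h (suc n) = begin
    ((f ∘ suc ⊛ g ⊕ f ⊛ (g ∘ suc)) ⊛ h) n + ((f ⊛ g) ⊛ (h ∘ suc)) n
      ≡⟨ cong (_+ ((f ⊛ g) ⊛ (h ∘ suc)) n) (⊛-distribʳ h (f ∘ suc ⊛ g) (f ⊛ (g ∘ suc)) n) ⟩
    ((f ∘ suc ⊛ g) ⊛ h) n + ((f ⊛ (g ∘ suc)) ⊛ h) n + ((f ⊛ g) ⊛ (h ∘ suc)) n
      ≡⟨ cong₂ _+_ (cong₂ _+_ (⊛-assoc (f ∘ suc) g h n) (⊛-assoc f (g ∘ suc) h n)) (⊛-assoc f g (h ∘ suc) n) ⟩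
    (f ∘ suc ⊛ (g ⊛ h)) n + (f ⊛ (g ∘ suc ⊛ h)) n + (f ⊛ (g ⊛ (h ∘ suc))) n
      ≡⟨ +-assoc _ _ _ ⟩
    (f ∘ suc ⊛ (g ⊛ h)) n + ((f ⊛ (g ∘ suc ⊛ h)) n + (f ⊛ (g ⊛ (h ∘ suc))) n)
      ≡⟨ cong ((f ∘ suc ⊛ (g ⊛ h)) n +_) (⊛-distribˡ f (g ∘ suc ⊛ h) (g ⊛ (h ∘ suc)) n) ⟨
    (f ∘ suc ⊛ (g ⊛ h)) n + (f ⊛ (g ∘ suc ⊛ h ⊕ g ⊛ (h ∘ suc))) n ∎

  ⊛-zeroˡ : ∀ f → 0ₛ ⊛ f ≗ 0ₛ
  ⊛-zeroˡ f n = trans (shuffle-cong n λ i j _ → zeroˡ (f j)) (shuffle-0 n)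

  ⊛-zeroʳ : ∀ f → f ⊛ 0ₛ ≗ 0ₛ
  ⊛-zeroʳ f n = trans (⊛-comm f 0ₛ n) (⊛-zeroˡ f n)

  ⊛-identityˡ : ∀ f → 1ₛ ⊛ f ≗ f
  ⊛-identityˡ f zero    = *-identityˡ (f 0)
  ⊛-identityˡ f (suc n) = trans (cong₂ _+_ (⊛-zeroˡ f n) (⊛-identityˡ (f ∘ suc) n)) (+-identityˡ _)

  ⊛-identityʳ : ∀ f → f ⊛ 1ₛ ≗ f
  ⊛-identityʳ f n = trans (⊛-comm f 1ₛ n) (⊛-identityˡ f n)

  series-isCommutativeSemiring : IsCommutativeSemiring _≗_ _⊕_ _⊛_ 0ₛ 1ₛ
  series-isCommutativeSemiring = record
    { isSemiring = record
      { isSemiringWithoutAnnihilatingZero = record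
        { +-isCommutativeMonoid = record
          { isMonoid = record
            { isSemigroup = record
              { isMagma = record
                { isEquivalence = record
                  { refl = λ _ → refl ; sym = λ p n → sym (p n) ; trans = λ p q n → trans (p n) (q n) }
                ; ∙-cong        = λ p q n → cong₂ _+_ (p n) (q n)
                }
              ; assoc = λ f g h n → +-assoc (f n) (g n) (h n)
              }
            ; identity = (λ f n → +-identityˡ (f n)) , (λ f n → +-identityʳ (f n))
            }
          ; comm = λ f g n → +-comm (f n) (g n)
          }
        ; *-cong     = ⊛-cong
        ; *-assoc    = ⊛-assoc
        ; *-identity = ⊛-identityˡ , ⊛-identityʳ
        ; distrib    = ⊛-distribˡ , ⊛-distribʳ
        }
      ; zero = ⊛-zeroˡ , ⊛-zeroʳ
      }
    ; *-comm = ⊛-comm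
    }

  seriesSemiring : CommutativeSemiring 0ℓ 0ℓ
  seriesSemiring = record { isCommutativeSemiring = series-isCommutativeSemiring }

  -- The monomial xᵃ, given by its constant term and its derivative. Against xⁿ/n! its coefficient
  -- is a! at n = a and 0 elsewhere.
  x^ : ℕ → Series
  x^ zero    zero    = 1#
  x^ zero    (suc n) = 0#
  x^ (suc a) zero    = 0#
  x^ (suc a) (suc n) = ι (suc a) * x^ a n

  x^-diag : ∀ n → x^ n n ≡ ι (n !)
  x^-diag zero    = sym (+-identityʳ 1#)
  x^-diag (suc n) = trans (cong (ι (suc n) *_) (x^-diag n)) (sym (ι-* (suc n) (n !)))

  x^-off : ∀ a n → a ≢ n → x^ a n ≡ 0#
  x^-off zero    zero    a≢n with () ← a≢n refl
  x^-off zero    (suc n) a≢n = refl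
  x^-off (suc a) zero    a≢n = refl
  x^-off (suc a) (suc n) a≢n = trans (cong (ι (suc a) *_) (x^-off a n (a≢n ∘ cong suc))) (zeroʳ _)

  ⊛-*ˡ : ∀ c f g n → ((λ i → c * f i) ⊛ g) n ≡ c * (f ⊛ g) n
  ⊛-*ˡ c f g n = trans (shuffle-cong n λ i j _ → *-assoc c (f i) (g j)) (shuffle-* c _ n)

  ⊛-*ʳ : ∀ c f g n → (f ⊛ (λ i → c * g i)) n ≡ c * (f ⊛ g) n
  ⊛-*ʳ c f g n = trans (⊛-comm f (λ i → c * g i) n) (trans (⊛-*ˡ c g f n) (cong (c *_) (⊛-comm g f n)))

  x^0≗1ₛ : x^ 0 ≗ 1ₛ
  x^0≗1ₛ zero    = refl
  x^0≗1ₛ (suc n) = refl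

  -- For positive exponents both sides have constant term 0 and, by the Leibniz rule, the derivative
  -- (a + b) x^(a+b-1).
  x^-+ : ∀ a b → x^ a ⊛ x^ b ≗ x^ (a ℕ.+ b)
  x^-+ zero    b n = trans (⊛-cong {g = x^ b} x^0≗1ₛ (λ _ → refl) n) (⊛-identityˡ (x^ b) n)
  x^-+ (suc a) zero n rewrite ℕ.+-identityʳ a = trans (⊛-cong {f = x^ (suc a)} (λ _ → refl) x^0≗1ₛ n)
      (⊛-identityʳ (x^ (suc a)) n)
  x^-+ (suc a) (suc b) zero    = zeroˡ _
  x^-+ (suc a) (suc b) (suc n) = begin
    ((λ i → ι (suc a) * x^ a i) ⊛ x^ (suc b)) n + (x^ (suc a) ⊛ (λ i → ι (suc b) * x^ b i)) n
      ≡⟨ cong₂ _+_ (⊛-*ˡ (ι (suc a)) (x^ a) (x^ (suc b)) n) (⊛-*ʳ (ι (suc b)) (x^ (suc a)) (x^ b) n) ⟩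
    ι (suc a) * (x^ a ⊛ x^ (suc b)) n + ι (suc b) * (x^ (suc a) ⊛ x^ b) n
      ≡⟨ cong₂ (λ p q → ι (suc a) * p + ι (suc b) * q) (x^-+ a (suc b) n)
          (trans (x^-+ (suc a) b n) (cong (λ k → x^ k n) (sym (ℕ.+-suc a b)))) ⟩
    ι (suc a) * x^ (a ℕ.+ suc b) n + ι (suc b) * x^ (a ℕ.+ suc b) n
      ≡⟨ distribʳ _ _ _ ⟨
    (ι (suc a) + ι (suc b)) * x^ (a ℕ.+ suc b) n
      ≡⟨ cong (_* x^ (a ℕ.+ suc b) n) (ι-+ (suc a) (suc b)) ⟨
    ι (suc a ℕ.+ suc b) * x^ (a ℕ.+ suc b) n ∎

  -- Sums over selections, splittings and arrangements

  Σlist : List B → (B → A) → A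
  Σlist []       F = 0#
  Σlist (x ∷ xs) F = F x + Σlist xs F

  -- The summand is passed as a continuation, so a bijection between ways to build a word becomes an
  -- identity in `A`, and unwanted words are discarded by a zero factor.
  Σsel : List B → (B → List B → A) → A
  Σsel []      K = 0#
  Σsel (x ∷ V) K = K x V + Σsel V (λ a V′ → K a (x ∷ V′))

  Σsplit : List B → (List B → List B → A) → A
  Σsplit []      K = K [] []
  Σsplit (x ∷ V) K = Σsplit V (λ S T → K (x ∷ S) T) + Σsplit V (λ S T → K S (x ∷ T))

  Σarr : ℕ → List B → (List B → A) → A
  Σarr zero    V F = F []
  Σarr (suc k) V F = Σsel V (λ a V′ → Σarr k V′ (F ∘ (a ∷_)))

  Σperm : List B → (List B → A) → A
  Σperm V = Σarr (length V) V

  Σsel-cong : ∀ (V : List B) {K L} → (∀ a V′ → V ↭ a ∷ V′ → K a V′ ≡ L a V′) → Σsel V K ≡ Σsel V L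
  Σsel-cong []      eq = refl
  Σsel-cong (x ∷ V) eq = cong₂ _+_ (eq x V ↭-refl)
    (Σsel-cong V λ a V′ p → eq a (x ∷ V′) (↭-trans (prep x p) (swap x a ↭-refl)))

  Σsel-+ : ∀ (V : List B) K L → Σsel V (λ a V′ → K a V′ + L a V′) ≡ Σsel V K + Σsel V L
  Σsel-+ []      K L = sym (+-identityˡ 0#)
  Σsel-+ (x ∷ V) K L = trans (cong (K x V + L x V +_) (Σsel-+ V _ _)) (+-interchange _ _ _ _)

  Σsel-* : ∀ c (V : List B) K → Σsel V (λ a V′ → c * K a V′) ≡ c * Σsel V K
  Σsel-* c []      K = sym (zeroʳ c)
  Σsel-* c (x ∷ V) K = trans (cong (c * K x V +_) (Σsel-* c V _)) (sym (distribˡ c _ _))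

  Σsel-0 : ∀ (V : List B) → Σsel V (λ _ _ → 0#) ≡ 0#
  Σsel-0 []      = refl
  Σsel-0 (x ∷ V) = trans (+-identityˡ _) (Σsel-0 V)

  Σsel-const : ∀ (V : List B) F → Σsel V (λ a _ → F a) ≡ Σlist V F
  Σsel-const []      F = refl
  Σsel-const (x ∷ V) F = cong (F x +_) (Σsel-const V F)

  Σsplit-cong : ∀ (V : List B) {K L} →
    (∀ S T → S ⊆ V → T ⊆ V → length S ℕ.+ length T ≡ length V → K S T ≡ L S T) → Σsplit V K ≡ Σsplit V L
  Σsplit-cong []      eq = eq [] [] [] [] refl
  Σsplit-cong (x ∷ V) eq = cong₂ _+_
    (Σsplit-cong V λ S T p q l → eq (x ∷ S) T (refl ∷ p) (x ∷ʳ q) (cong suc l))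
    (Σsplit-cong V λ S T p q l → eq S (x ∷ T) (x ∷ʳ p) (refl ∷ q)
        (trans (ℕ.+-suc (length S) (length T)) (cong suc l)))

  Σsplit-+ : ∀ (V : List B) K L → Σsplit V (λ S T → K S T + L S T) ≡ Σsplit V K + Σsplit V L
  Σsplit-+ []      K L = refl
  Σsplit-+ (x ∷ V) K L = trans (cong₂ _+_ (Σsplit-+ V _ _) (Σsplit-+ V _ _)) (+-interchange _ _ _ _)

  -- Both sides branch alike, on the side that receives the head letter. This is where binomial
  -- coefficients enter the counting.
  Σsplit-length : ∀ (V : List B) h → Σsplit V (λ S T → h (length S) (length T)) ≡ shuffle h (length V)
  Σsplit-length []      h = refl
  Σsplit-length (x ∷ V) h = cong₂ _+_ (Σsplit-length V _) (Σsplit-length V _)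

  Σarr-cong : ∀ k (V : List B) {F G} → length V ≡ k → (∀ w → w ↭ V → F w ≡ G w) → Σarr k V F ≡ Σarr k V G
  Σarr-cong zero    []      _ eq = eq [] ↭-refl
  Σarr-cong (suc k) V       l eq = Σsel-cong V λ a V′ p →
    Σarr-cong k V′ (ℕ.suc-injective (trans (sym (↭-length p)) l)) λ w q → eq (a ∷ w) (↭-trans (prep a q) (↭-sym p))

  Σarr-* : ∀ c k (V : List B) F → Σarr k V (λ w → c * F w) ≡ c * Σarr k V F
  Σarr-* c zero    V F = refl
  Σarr-* c (suc k) V F = trans (Σsel-cong V λ a V′ _ → Σarr-* c k V′ (F ∘ (a ∷_))) (Σsel-* c V _)

  Σarr-+ : ∀ k (V : List B) F G → Σarr k V (λ w → F w + G w) ≡ Σarr k V F + Σarr k V G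
  Σarr-+ zero    V F G = refl
  Σarr-+ (suc k) V F G = trans (Σsel-cong V λ a V′ _ → Σarr-+ k V′ _ _) (Σsel-+ V _ _)

  Σarr-0 : ∀ k (V : List B) → Σarr k V (λ _ → 0#) ≡ 0#
  Σarr-0 zero    V = refl
  Σarr-0 (suc k) V = trans (Σsel-cong V λ a V′ _ → Σarr-0 k V′) (Σsel-0 V)

  Σperm-cong : ∀ (V : List B) {F G} → (∀ w → w ↭ V → F w ≡ G w) → Σperm V F ≡ Σperm V G
  Σperm-cong V = Σarr-cong (length V) V refl

  Σperm-× : ∀ c (S T : List B) F G →
    Σperm S (λ u → Σperm T (λ v → c * (F u * G v))) ≡ c * (Σperm S F * Σperm T G)
  Σperm-× c S T F G = begin
    Σperm S (λ u → Σperm T (λ v → c * (F u * G v)))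
      ≡⟨ Σperm-cong S (λ u _ → trans (Σarr-* c (length T) T _)
          (cong (c *_) (trans (Σarr-* (F u) (length T) T G) (*-comm (F u) _)))) ⟩
    Σperm S (λ u → c * (Σperm T G * F u))
      ≡⟨ trans (Σarr-* c (length S) S _) (cong (c *_) (Σarr-* (Σperm T G) (length S) S F)) ⟩
    c * (Σperm T G * Σperm S F)
      ≡⟨ cong (c *_) (*-comm _ _) ⟩
    c * (Σperm S F * Σperm T G) ∎

  Σperm-1ₛ : ∀ (V : List B) → Σperm V (1ₛ ∘ length) ≡ 1ₛ (length V)
  Σperm-1ₛ []      = refl
  Σperm-1ₛ (x ∷ V) = Σarr-0 (suc (length V)) (x ∷ V)

  -- Marking a letter on the left of a split, or marking a letter and splitting the others,
  -- describes the same triples `a`, `S′`, `T`.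
  Σsplit-Σsel : ∀ (V : List B) (K : B → List B → List B → A) →
    Σsplit V (λ S T → Σsel S (λ a S′ → K a S′ T)) ≡ Σsel V (λ a V′ → Σsplit V′ (K a))
  Σsplit-Σsel []      K = refl
  Σsplit-Σsel (x ∷ V) K = begin
    Σsplit V (λ S T → K x S T + Σsel S (λ a S′ → K a (x ∷ S′) T)) +
        Σsplit V (λ S T → Σsel S (λ a S′ → K a S′ (x ∷ T)))
      ≡⟨ cong (_+ Σsplit V (λ S T → Σsel S (λ a S′ → K a S′ (x ∷ T)))) (Σsplit-+ V (K x) _) ⟩
    Σsplit V (K x) + Σsplit V (λ S T → Σsel S (λ a S′ → K a (x ∷ S′) T)) +
        Σsplit V (λ S T → Σsel S (λ a S′ → K a S′ (x ∷ T)))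
      ≡⟨ +-assoc _ _ _ ⟩
    Σsplit V (K x) + (Σsplit V (λ S T → Σsel S (λ a S′ → K a (x ∷ S′) T)) +
        Σsplit V (λ S T → Σsel S (λ a S′ → K a S′ (x ∷ T))))
      ≡⟨ cong (Σsplit V (K x) +_) (cong₂ _+_ (Σsplit-Σsel V _) (Σsplit-Σsel V _)) ⟩
    Σsplit V (K x) + (Σsel V (λ a V′ → Σsplit V′ (λ S T → K a (x ∷ S) T)) +
        Σsel V (λ a V′ → Σsplit V′ (λ S T → K a S (x ∷ T))))
      ≡⟨ cong (Σsplit V (K x) +_) (Σsel-+ V _ _) ⟨
    Σsplit V (K x) + Σsel V (λ a V′ → Σsplit (x ∷ V′) (K a)) ∎

  null : List B → A
  null = 1ₛ ∘ length

  Σsplit-null : ∀ (V : List B) (H : List B → A) → Σsplit V (λ S T → null S * H T) ≡ H V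
  Σsplit-null []      H = *-identityˡ _
  Σsplit-null (x ∷ V) H = begin
    Σsplit V (λ S T → 0# * H T) + Σsplit V (λ S T → null S * H (x ∷ T))
      ≡⟨ cong₂ _+_ (trans (Σsplit-cong V λ S T _ _ _ → zeroˡ (H T)) (Σsplit-0 V)) (Σsplit-null V (H ∘ (x ∷_))) ⟩
    0# + H (x ∷ V) ≡⟨ +-identityˡ _ ⟩
    H (x ∷ V) ∎
    where
    Σsplit-0 : ∀ (V : List B) → Σsplit V (λ _ _ → 0#) ≡ 0#
    Σsplit-0 V = trans (Σsplit-length V (λ _ _ → 0#)) (shuffle-0 (length V))

  -- One formula for empty and nonempty `V`: the first summand survives only for the empty list. It
  -- is applied under a sum over splits, where `S` may be either.
  Σperm-first : ∀ (V : List B) F → Σperm V F ≡ null V * F [] + Σsel V (λ a V′ → Σperm V′ (F ∘ (a ∷_)))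
  Σperm-first []      F = sym (trans (+-identityʳ _) (*-identityˡ _))
  Σperm-first (x ∷ V) F = begin
    Σsel (x ∷ V) (λ a V′ → Σarr (length V) V′ (F ∘ (a ∷_)))
      ≡⟨ Σsel-cong (x ∷ V) (λ a V′ p → cong (λ k → Σarr k V′ (F ∘ (a ∷_))) (ℕ.suc-injective (↭-length p))) ⟩
    Σsel (x ∷ V) (λ a V′ → Σperm V′ (F ∘ (a ∷_)))
      ≡⟨ +-identityˡ _ ⟨
    0# + Σsel (x ∷ V) (λ a V′ → Σperm V′ (F ∘ (a ∷_)))
      ≡⟨ cong (_+ Σsel (x ∷ V) (λ a V′ → Σperm V′ (F ∘ (a ∷_)))) (zeroˡ (F [])) ⟨
    0# * F [] + Σsel (x ∷ V) (λ a V′ → Σperm V′ (F ∘ (a ∷_))) ∎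

  -- Induction along the word. If `M` comes first then `u` is empty; otherwise the first letter `a`
  -- belongs to `u`, and `Σsplit-Σsel` lets it be chosen before the other letters are split.
  Σperm-pivot : ∀ (M : B) V F →
    Σperm (M ∷ V) F ≡ Σsplit V (λ S T → Σperm S (λ u → Σperm T (λ v → F (u ++ M ∷ v))))
  Σperm-pivot {B} M V F = go (length V) V F refl
    where
    go : ∀ n (V : List B) F → length V ≡ n →
      Σperm (M ∷ V) F ≡ Σsplit V (λ S T → Σperm S (λ u → Σperm T (λ v → F (u ++ M ∷ v))))
    rest : ∀ n (V : List B) F → length V ≡ n →
      Σsel V (λ a V′ → Σarr (length V) (M ∷ V′) (F ∘ (a ∷_))) ≡
      Σsel V (λ a V′ → Σsplit V′ (λ S T → Σperm S (λ u → Σperm T (λ v → F (a ∷ u ++ M ∷ v)))))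
    rest zero    []      F _ = refl
    rest (suc n) V F l = Σsel-cong V λ a V′ p →
      trans (cong (λ k → Σarr k (M ∷ V′) (F ∘ (a ∷_))) (↭-length p))
              (go n V′ (F ∘ (a ∷_)) (ℕ.suc-injective (trans (sym (↭-length p)) l)))
    go n V F l = begin
      Σperm V (F ∘ (M ∷_)) + Σsel V (λ a V′ → Σarr (length V) (M ∷ V′) (F ∘ (a ∷_)))
        ≡⟨ cong (Σperm V (F ∘ (M ∷_)) +_) (trans (rest n V F l) (sym (Σsplit-Σsel V _))) ⟩
      Σperm V (F ∘ (M ∷_)) + Σsplit V (λ S T → Σsel S (λ a S′ → Σperm S′ (λ u → Σperm T (λ v → F (a ∷ u ++ M ∷ v)))))
        ≡⟨ cong₂ _+_ (Σsplit-null V (λ T → Σperm T (λ v → F (M ∷ v)))) refl ⟨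
      Σsplit V (λ S T → null S * Σperm T (λ v → F (M ∷ v))) +
          Σsplit V (λ S T → Σsel S (λ a S′ → Σperm S′ (λ u → Σperm T (λ v → F (a ∷ u ++ M ∷ v)))))
        ≡⟨ Σsplit-+ V _ _ ⟨
      Σsplit V (λ S T → null S * Σperm T (λ v → F (M ∷ v)) +
          Σsel S (λ a S′ → Σperm S′ (λ u → Σperm T (λ v → F (a ∷ u ++ M ∷ v)))))
        ≡⟨ Σsplit-cong V (λ S T _ _ _ → Σperm-first S (λ u → Σperm T (λ v → F (u ++ M ∷ v)))) ⟨
      Σsplit V (λ S T → Σperm S (λ u → Σperm T (λ v → F (u ++ M ∷ v)))) ∎

  Σlist-cong : ∀ (xs : List B) {F G} → F ≗ G → Σlist xs F ≡ Σlist xs G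
  Σlist-cong []       eq = refl
  Σlist-cong (x ∷ xs) eq = cong₂ _+_ (eq x) (Σlist-cong xs eq)

  Σlist-↭ : ∀ {xs ys : List B} F → xs ↭ ys → Σlist xs F ≡ Σlist ys F
  Σlist-↭ F _↭_.refl        = refl
  Σlist-↭ F (prep x p)   = cong (F x +_) (Σlist-↭ F p)
  Σlist-↭ F (swap x y p) = trans (sym (+-assoc _ _ _)) (trans (cong₂ _+_ (+-comm _ _) (Σlist-↭ F p)) (+-assoc _ _ _))
  Σlist-↭ F (_↭_.trans p q)  = trans (Σlist-↭ F p) (Σlist-↭ F q)

  Πlist : List B → (B → A) → A
  Πlist []       F = 1#
  Πlist (x ∷ xs) F = F x * Πlist xs F

  Πlist-cong : ∀ (xs : List B) {F G} → F ≗ G → Πlist xs F ≡ Πlist xs G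
  Πlist-cong []       eq = refl
  Πlist-cong (x ∷ xs) eq = cong₂ _*_ (eq x) (Πlist-cong xs eq)

  Πlist-* : ∀ (xs : List B) F G → Πlist xs (λ x → F x * G x) ≡ Πlist xs F * Πlist xs G
  Πlist-* []       F G = sym (*-identityˡ 1#)
  Πlist-* (x ∷ xs) F G = trans (cong (F x * G x *_) (Πlist-* xs F G)) (*-interchange _ _ _ _)

  Πlist-1 : ∀ (xs : List B) → Πlist xs (λ _ → 1#) ≡ 1#
  Πlist-1 []       = refl
  Πlist-1 (x ∷ xs) = trans (*-identityˡ _) (Πlist-1 xs)

  Πlist-↭ : ∀ {xs ys : List B} F → xs ↭ ys → Πlist xs F ≡ Πlist ys F
  Πlist-↭ F _↭_.refl        = refl
  Πlist-↭ F (prep x p)   = cong (F x *_) (Πlist-↭ F p)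
  Πlist-↭ F (swap x y p) = trans (sym (*-assoc _ _ _)) (trans (cong₂ _*_ (*-comm _ _) (Πlist-↭ F p)) (*-assoc _ _ _))
  Πlist-↭ F (_↭_.trans p q)  = trans (Πlist-↭ F p) (Πlist-↭ F q)

  -- Used for products over all part sizes: adding a part `c` changes only the factor at `c`.
  Πlist-unique : ∀ {xs : List B} {F G c y} → Unique xs → c ∈ xs → F c ≡ y * G c → (∀ x → c ≢ x → F x ≡ G x) →
    Πlist xs F ≡ y * Πlist xs G
  Πlist-unique {xs = x ∷ xs} {F} {G} {y = y} (x∉xs ∷ _) (here refl) Fc F≗G =
    trans (cong₂ _*_ Fc (off xs x∉xs)) (*-assoc y (G x) _)
    where
    off : ∀ xs → All (x ≢_) xs → Πlist xs F ≡ Πlist xs G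
    off []       []          = refl
    off (z ∷ zs) (x≢z ∷ x∉zs) = cong₂ _*_ (F≗G z x≢z) (off zs x∉zs)
  Πlist-unique {xs = x ∷ xs} {F} {G} {y = y} (x∉xs ∷ xs!) (there c∈xs) Fc F≗G =
    trans (cong₂ _*_ (F≗G x (λ { refl → All.lookup x∉xs c∈xs refl })) (Πlist-unique xs! c∈xs Fc F≗G))
      (trans (sym (*-assoc _ _ _)) (trans (cong (_* Πlist xs G) (*-comm (G x) y)) (*-assoc _ _ _)))

  Σlist-++ : ∀ (xs ys : List B) F → Σlist (xs ++ ys) F ≡ Σlist xs F + Σlist ys F
  Σlist-++ []       ys F = sym (+-identityˡ _)
  Σlist-++ (x ∷ xs) ys F = trans (cong (F x +_) (Σlist-++ xs ys F)) (sym (+-assoc _ _ _))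

  Σlist-map : ∀ (g : B → D) xs F → Σlist (map g xs) F ≡ Σlist xs (F ∘ g)
  Σlist-map g []       F = refl
  Σlist-map g (x ∷ xs) F = cong (F (g x) +_) (Σlist-map g xs F)

  Σlist-concatMap : ∀ (g : B → List D) xs F → Σlist (concatMap g xs) F ≡ Σlist xs (λ x → Σlist (g x) F)
  Σlist-concatMap g []       F = refl
  Σlist-concatMap g (x ∷ xs) F = trans (Σlist-++ (g x) (concatMap g xs) F)
      (cong (Σlist (g x) F +_) (Σlist-concatMap g xs F))

  Σword : ℕ → List B → (List B → A) → A
  Σword zero    V F = F []
  Σword (suc k) V F = Σlist V (λ a → Σword k V (F ∘ (a ∷_)))

  Σlist-words : ∀ k m F → Σlist (words k m) F ≡ Σword k (upTo m) F
  Σlist-words zero    m F = +-identityʳ _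
  Σlist-words (suc k) m F = trans (Σlist-concatMap _ (upTo m) F)
    (Σlist-cong (upTo m) λ a → trans (Σlist-map (a ∷_) (words k m) F) (Σlist-words k m (F ∘ (a ∷_))))

  Σword-cong : ∀ k (V : List B) {F G} → (∀ w → length w ≡ k → F w ≡ G w) → Σword k V F ≡ Σword k V G
  Σword-cong zero    V eq = eq [] refl
  Σword-cong (suc k) V eq = Σlist-cong V λ a → Σword-cong k V λ w l → eq (a ∷ w) (cong suc l)

  Σword-↭ : ∀ k {V W : List B} F → V ↭ W → Σword k V F ≡ Σword k W F
  Σword-↭ zero    F p = refl
  Σword-↭ (suc k) {V} F p = trans (Σlist-cong V λ a → Σword-↭ k (F ∘ (a ∷_)) p) (Σlist-↭ _ p)

  Σword-0 : ∀ k (V : List B) → Σword k V (λ _ → 0#) ≡ 0#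
  Σword-0 zero    V = refl
  Σword-0 (suc k) V = trans (Σlist-cong V λ _ → Σword-0 k V) (Σlist-0 V)
    where
    Σlist-0 : ∀ (xs : List B) → Σlist xs (λ _ → 0#) ≡ 0#
    Σlist-0 []       = refl
    Σlist-0 (x ∷ xs) = trans (+-identityˡ _) (Σlist-0 xs)

  Σword-avoid : ∀ k a {V} F → All (a ≢_) V →
    Σword k (a ∷ V) (λ w → ⟦ not (any (a ≡ᵇ_) w) ⟧ * F w) ≡ Σword k V F
  Σword-avoid zero    a F a∉V = *-identityˡ _
  Σword-avoid (suc k) a {V} F a∉V = begin
    Σword k (a ∷ V) (λ w → ⟦ not ((a ≡ᵇ a) ∨ any (a ≡ᵇ_) w) ⟧ * F (a ∷ w)) + others V
      ≡⟨ cong (_+ others V) (trans (Σword-cong k (a ∷ V) λ w _ →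
          trans (cong (λ b → ⟦ not (b ∨ any (a ≡ᵇ_) w) ⟧ * F (a ∷ w)) (≡ᵇ-refl a)) (zeroˡ _)) (Σword-0 k (a ∷ V))) ⟩
    0# + others V   ≡⟨ +-identityˡ _ ⟩
    others V        ≡⟨ each V a∉V ⟩
    Σlist V (λ b → Σword k V (F ∘ (b ∷_))) ∎
    where
    others : List ℕ → A
    others W = Σlist W (λ b → Σword k (a ∷ V) (λ w → ⟦ not ((a ≡ᵇ b) ∨ any (a ≡ᵇ_) w) ⟧ * F (b ∷ w)))
    each : ∀ W → All (a ≢_) W → others W ≡ Σlist W (λ b → Σword k V (F ∘ (b ∷_)))
    each []      []           = refl
    each (b ∷ W) (a≢b ∷ a∉W) = cong₂ _+_
      (trans (Σword-cong k (a ∷ V) λ w _ →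
          cong (λ c → ⟦ not (c ∨ any (a ≡ᵇ_) w) ⟧ * F (b ∷ w)) (≢⇒≡ᵇ-false a≢b)) (Σword-avoid k a (F ∘ (b ∷_)) a∉V))
      (each W a∉W)

  -- The alphabet of `Σword` stays fixed while that of `Σarr` shrinks. Distinctness bars the first
  -- letter `a` from the rest of the word; with `a` moved to the front of the alphabet,
  -- `Σword-avoid` deletes it.
  Σword-distinct : ∀ k {V} F → Unique V → Σword k V (λ w → ⟦ distinct w ⟧ * F w) ≡ Σarr k V F
  Σword-distinct zero    F V! = *-identityˡ _
  Σword-distinct (suc k) {V} F V! = trans (sym (Σsel-const V _)) (Σsel-cong V step)
    where
    step : ∀ a V′ → V ↭ a ∷ V′ →
      Σword k V (λ w → ⟦ not (any (a ≡ᵇ_) w) ∧ distinct w ⟧ * F (a ∷ w)) ≡ Σarr k V′ (F ∘ (a ∷_))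
    step a V′ p with a∉V′ ∷ V′! ← Permutation.Unique-resp-↭ (setoid ℕ) (↭⇒↭ₛ p) V! = begin
      Σword k V (λ w → ⟦ not (any (a ≡ᵇ_) w) ∧ distinct w ⟧ * F (a ∷ w))
        ≡⟨ Σword-↭ k _ p ⟩
      Σword k (a ∷ V′) (λ w → ⟦ not (any (a ≡ᵇ_) w) ∧ distinct w ⟧ * F (a ∷ w))
        ≡⟨ Σword-cong k (a ∷ V′) (λ w _ →
            trans (cong (_* F (a ∷ w)) (⟦⟧-∧ (not (any (a ≡ᵇ_) w)) (distinct w))) (*-assoc _ _ _)) ⟩
      Σword k (a ∷ V′) (λ w → ⟦ not (any (a ≡ᵇ_) w) ⟧ * (⟦ distinct w ⟧ * F (a ∷ w)))
        ≡⟨ Σword-avoid k a _ a∉V′ ⟩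
      Σword k V′ (λ w → ⟦ distinct w ⟧ * F (a ∷ w))
        ≡⟨ Σword-distinct k (F ∘ (a ∷_)) V′! ⟩
      Σarr k V′ (F ∘ (a ∷_)) ∎

  Σlist-filter : ∀ (P : B → Bool) xs → ι (length (filterᵇ P xs)) ≡ Σlist xs (⟦_⟧ ∘ P)
  Σlist-filter P []       = refl
  Σlist-filter P (x ∷ xs) with P x
  ... | true  = cong (1# +_) (Σlist-filter P xs)
  ... | false = trans (Σlist-filter P xs) (sym (+-identityˡ _))

  -- Counting by the cut at the maximum

  altCount : List ℕ → A
  altCount V = Σperm V (⟦_⟧ ∘ altUp)

  -- The Euler zigzag numbers 1, 1, 1, 2, 5, 16, ...; those of odd index are the tangent numbers.
  e : Series
  e n = altCount (downFrom n)

  -- In an up-down word the maximum is a peak after an odd number of letters, or else the only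
  -- letter, which is the second summand. The coefficient `1#` there gives both summands the shape
  -- that `Σperm-×` takes.
  ⟦altUp⟧-pivot : ∀ {M} u v → All (_< M) u → All (_< M) v →
    ⟦ altUp (u ++ M ∷ v) ⟧ ≡ ⟦ odd (length u) ⟧ * (⟦ altUp u ⟧ * ⟦ altUp v ⟧) + 1# * (null u * null v)
  ⟦altUp⟧-pivot {M} [] v _ v<M = sym (trans (cong₂ _+_ (zeroˡ _) (trans (*-identityˡ _) (*-identityˡ _)))
                                       (trans (+-identityˡ _) (only-[] v v<M)))
    where
    only-[] : ∀ v → All (_< M) v → null v ≡ ⟦ altUp (M ∷ v) ⟧
    only-[] []      _         = refl
    only-[] (y ∷ v) (y<M ∷ _) rewrite <⇒>ᵇ-false y<M = refl
  ⟦altUp⟧-pivot {M} (x ∷ u) v xu<M v<M = begin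
    ⟦ altUp (x ∷ u ++ M ∷ v) ⟧
      ≡⟨ cong ⟦_⟧ (altUp-pivot x u v xu<M v<M) ⟩
    ⟦ odd (length (x ∷ u)) ∧ altUp (x ∷ u) ∧ altUp v ⟧
      ≡⟨ trans (⟦⟧-∧ (odd (length (x ∷ u))) _) (cong (⟦ odd (length (x ∷ u)) ⟧ *_) (⟦⟧-∧ (altUp (x ∷ u)) (altUp v))) ⟩
    ⟦ odd (length (x ∷ u)) ⟧ * (⟦ altUp (x ∷ u) ⟧ * ⟦ altUp v ⟧)
      ≡⟨ +-identityʳ _ ⟨
    ⟦ odd (length (x ∷ u)) ⟧ * (⟦ altUp (x ∷ u) ⟧ * ⟦ altUp v ⟧) + 0#
      ≡⟨ cong₂ _+_ refl (trans (*-identityˡ _) (zeroˡ (null v))) ⟨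
    ⟦ odd (length (x ∷ u)) ⟧ * (⟦ altUp (x ∷ u) ⟧ * ⟦ altUp v ⟧) + 1# * (0# * null v) ∎

  Σperm²-cong : ∀ {S T : List ℕ} {F G : List ℕ → List ℕ → A} → (∀ u v → u ↭ S → v ↭ T → F u v ≡ G u v) →
    Σperm S (λ u → Σperm T (F u)) ≡ Σperm S (λ u → Σperm T (G u))
  Σperm²-cong {S} {T} eq = Σperm-cong S λ u p → Σperm-cong T λ v q → eq u v p q

  altCount-∷ : ∀ {M} V → All (_< M) V →
    altCount (M ∷ V) ≡ Σsplit V (λ S T → ⟦ odd (length S) ⟧ * (altCount S * altCount T) + null S * null T)
  altCount-∷ {M} V V<M = trans (Σperm-pivot M V (⟦_⟧ ∘ altUp)) (Σsplit-cong V split)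
    where
    split : ∀ S T → S ⊆ V → T ⊆ V → length S ℕ.+ length T ≡ length V →
      Σperm S (λ u → Σperm T (λ v → ⟦ altUp (u ++ M ∷ v) ⟧)) ≡
      ⟦ odd (length S) ⟧ * (altCount S * altCount T) + null S * null T
    split S T S⊆V T⊆V _ = begin
      Σperm S (λ u → Σperm T (λ v → ⟦ altUp (u ++ M ∷ v) ⟧))
        ≡⟨ Σperm²-cong (λ u v p q → trans
             (⟦altUp⟧-pivot u v (All-resp-↭ (↭-sym p) (All-resp-⊆ S⊆V V<M))
                 (All-resp-↭ (↭-sym q) (All-resp-⊆ T⊆V V<M)))
             (cong (λ l → ⟦ odd l ⟧ * (⟦ altUp u ⟧ * ⟦ altUp v ⟧) + 1# * (null u * null v)) (↭-length p))) ⟩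
      Σperm S (λ u → Σperm T (λ v → ⟦ odd (length S) ⟧ * (⟦ altUp u ⟧ * ⟦ altUp v ⟧) + 1# * (null u * null v)))
        ≡⟨ trans (Σperm-cong S λ u _ → Σarr-+ (length T) T _ _) (Σarr-+ (length S) S _ _) ⟩
      Σperm S (λ u → Σperm T (λ v → ⟦ odd (length S) ⟧ * (⟦ altUp u ⟧ * ⟦ altUp v ⟧))) +
          Σperm S (λ u → Σperm T (λ v → 1# * (null u * null v)))
        ≡⟨ cong₂ _+_ (Σperm-× _ S T _ _) (Σperm-× 1# S T null null) ⟩
      ⟦ odd (length S) ⟧ * (altCount S * altCount T) + 1# * (Σperm S null * Σperm T null)
        ≡⟨ cong₂ _+_ refl (trans (*-identityˡ _) (cong₂ _*_ (Σperm-1ₛ S) (Σperm-1ₛ T))) ⟩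
      ⟦ odd (length S) ⟧ * (altCount S * altCount T) + null S * null T ∎

  altCount-shuffle : ∀ n V → length V ≡ n → (∀ S → S ⊆ V → altCount S ≡ e (length S)) →
    Σsplit V (λ S T → ⟦ odd (length S) ⟧ * (altCount S * altCount T) + null S * null T) ≡
    shuffle (λ i j → ⟦ odd i ⟧ * (e i * e j)) n + 1ₛ n
  altCount-shuffle n V refl eq = begin
    Σsplit V (λ S T → ⟦ odd (length S) ⟧ * (altCount S * altCount T) + null S * null T)
      ≡⟨ Σsplit-cong V (λ S T S⊆V T⊆V _ →
          cong₂ (λ p q → ⟦ odd (length S) ⟧ * (p * q) + null S * null T) (eq S S⊆V) (eq T T⊆V)) ⟩
    Σsplit V (λ S T → ⟦ odd (length S) ⟧ * (e (length S) * e (length T)) + null S * null T)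
      ≡⟨ Σsplit-length V (λ i j → ⟦ odd i ⟧ * (e i * e j) + 1ₛ i * 1ₛ j) ⟩
    shuffle (λ i j → ⟦ odd i ⟧ * (e i * e j) + 1ₛ i * 1ₛ j) n
      ≡⟨ trans (shuffle-+ _ _ n) (cong₂ _+_ refl (⊛-identityˡ 1ₛ n)) ⟩
    shuffle (λ i j → ⟦ odd i ⟧ * (e i * e j)) n + 1ₛ n ∎

  -- Strong induction on the length: the cut at the head gives `V` and `downFrom` the same recursion
  -- in terms of shorter alphabets.
  altCount-length : ∀ V → Descending V → altCount V ≡ e (length V)
  altCount-length V = go (length V) V ℕ.≤-refl
    where
    go : ∀ n V → length V ≤ n → Descending V → altCount V ≡ e (length V)
    go n       []      _         _          = refl
    go (suc n) (M ∷ V) (s≤s V≤n) (V<M ∷ V↓) = begin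
      altCount (M ∷ V)          ≡⟨ altCount-∷ V V<M ⟩
      _                         ≡⟨ altCount-shuffle l V refl (shorter V V≤n V↓) ⟩
      _                         ≡⟨ altCount-shuffle l (downFrom l) l-downFrom
          (shorter (downFrom l) (subst (_≤ n) (sym l-downFrom) V≤n) (descending-downFrom l)) ⟨
      _                         ≡⟨ altCount-∷ (downFrom l) (All.tabulate ∈-downFrom⁻) ⟨
      e (suc l)                 ∎
      where
      l = length V
      l-downFrom = length-downFrom l
      shorter : ∀ W → length W ≤ n → Descending W → ∀ S → S ⊆ W → altCount S ≡ e (length S)
      shorter W W≤n W↓ S S⊆W = go n S (ℕ.≤-trans (length-mono-≤ S⊆W) W≤n) (descending-⊆ S⊆W W↓)

  e-suc : ∀ n → e (suc n) ≡ shuffle (λ i j → ⟦ odd i ⟧ * (e i * e j)) n + 1ₛ n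
  e-suc n = trans (altCount-∷ (downFrom n) (All.tabulate ∈-downFrom⁻))
    (altCount-shuffle n (downFrom n) (length-downFrom n) λ S S⊆V →
        altCount-length S (descending-⊆ S⊆V (descending-downFrom n)))

  -- Equal parts count as distinct: an ordering that spells r is counted once per labelling of its parts.
  orderings : List ℕ → List ℕ → A
  orderings ps []      = null ps
  orderings ps (c ∷ r) = Σsel ps (λ a ps′ → ⟦ a ≡ᵇ c ⟧ * orderings ps′ r)

  -- The cut at the maximum creates the last gap; reversing puts it first, where `orderings` removes
  -- it from `ps`.
  recordCount : List ℕ → List ℕ → A
  recordCount ps V = Σperm V (λ w → ⟦ altDown w ⟧ * orderings ps (reverse (gapsOf w)))

  -- `Φ` is any additive functional; it is taken to be a sum over words and also a `shuffle` over
  -- pairs of lengths.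
  Σsel-swap : ∀ {D : Set} (Φ : (D → A) → A) →
    Φ (λ _ → 0#) ≡ 0# → (∀ F G → Φ (λ i → F i + G i) ≡ Φ F + Φ G) →
    ∀ (V : List B) (K : D → B → List B → A) →
    Φ (λ i → Σsel V (K i)) ≡ Σsel V (λ a V′ → Φ (λ i → K i a V′))
  Σsel-swap Φ Φ-0 Φ-+ []      K = Φ-0
  Σsel-swap Φ Φ-0 Φ-+ (x ∷ V) K = trans (Φ-+ _ _) (cong (Φ (λ i → K i x V) +_) (Σsel-swap Φ Φ-0 Φ-+ V _))

  -- The parity factor stands outside because `gapsOf-pivot` needs `u` to have even length; for odd
  -- length both sides vanish.
  split-words : ∀ {M} ps u v → All (_< M) u → All (_< M) v →
    ⟦ altDown (u ++ M ∷ v) ⟧ * orderings ps (reverse (gapsOf (u ++ M ∷ v))) ≡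
    ⟦ even (length u) ⟧ * Σsel ps (λ a ps′ → ⟦ a ≡ᵇ ⌊ suc (length v) /2⌋ ⟧ *
      ((⟦ altDown u ⟧ * orderings ps′ (reverse (gapsOf u))) * ⟦ altUp v ⟧))
  split-words {M} ps u v u<M v<M rewrite altDown-pivot u v u<M v<M with even (length u) in even-u
  ... | false = trans (zeroˡ _) (sym (zeroˡ _))
  ... | true  = begin
    ⟦ altDown u ∧ altUp v ⟧ * orderings ps (reverse (gapsOf (u ++ M ∷ v)))
      ≡⟨ cong₂ _*_ (⟦⟧-∧ (altDown u) (altUp v))
          (cong (orderings ps) (trans (cong reverse (gapsOf-pivot u v u<M v<M even-u))
          (reverse-++ (gapsOf u) [ c ]))) ⟩
    ⟦ altDown u ⟧ * ⟦ altUp v ⟧ * Σsel ps (λ a ps′ → ⟦ a ≡ᵇ c ⟧ * orderings ps′ (reverse (gapsOf u)))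
      ≡⟨ Σsel-* _ ps _ ⟨
    Σsel ps (λ a ps′ → ⟦ altDown u ⟧ * ⟦ altUp v ⟧ * (⟦ a ≡ᵇ c ⟧ * orderings ps′ (reverse (gapsOf u))))
      ≡⟨ Σsel-cong ps (λ a ps′ _ → rearrange ⟦ altDown u ⟧ ⟦ altUp v ⟧ ⟦ a ≡ᵇ c ⟧
          (orderings ps′ (reverse (gapsOf u)))) ⟩
    Σsel ps (λ a ps′ → ⟦ a ≡ᵇ c ⟧ * ((⟦ altDown u ⟧ * orderings ps′ (reverse (gapsOf u))) * ⟦ altUp v ⟧))
      ≡⟨ *-identityˡ _ ⟨
    1# * Σsel ps (λ a ps′ → ⟦ a ≡ᵇ c ⟧ * ((⟦ altDown u ⟧ * orderings ps′ (reverse (gapsOf u))) * ⟦ altUp v ⟧)) ∎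
    where
    c = ⌊ suc (length v) /2⌋
    rearrange : ∀ d u a o → d * u * (a * o) ≡ a * ((d * o) * u)
    rearrange = solve 4 (λ d u a o → d :* u :* (a :* o) := a :* ((d :* o) :* u)) refl

  -- For fixed letter sets and fixed `a` the conditions on `u` and `v` are independent, so the sum
  -- over pairs factors, and the factor of `v` depends on the length of `T` only.
  recordCount-∷ : ∀ {M} ps V → All (_< M) V → Descending V →
    recordCount ps (M ∷ V) ≡ Σsplit V (λ S T → ⟦ even (length S) ⟧ * Σsel ps (λ a ps′ →
      ⟦ a ≡ᵇ ⌊ suc (length T) /2⌋ ⟧ * (recordCount ps′ S * e (length T))))
  recordCount-∷ {M} ps V V<M V↓ = trans (Σperm-pivot M V (λ w → ⟦ altDown w ⟧ *
      orderings ps (reverse (gapsOf w)))) (Σsplit-cong V split)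
    where
    split : ∀ S T → S ⊆ V → T ⊆ V → length S ℕ.+ length T ≡ length V →
      Σperm S (λ u → Σperm T (λ v → ⟦ altDown (u ++ M ∷ v) ⟧ * orderings ps (reverse (gapsOf (u ++ M ∷ v))))) ≡
      ⟦ even (length S) ⟧ * Σsel ps (λ a ps′ → ⟦ a ≡ᵇ ⌊ suc (length T) /2⌋ ⟧ * (recordCount ps′ S * e (length T)))
    split S T S⊆V T⊆V _ = begin
      Σperm S (λ u → Σperm T (λ v → ⟦ altDown (u ++ M ∷ v) ⟧ * orderings ps (reverse (gapsOf (u ++ M ∷ v)))))
        ≡⟨ Σperm²-cong (λ u v p q → trans
             (split-words ps u v (All-resp-↭ (↭-sym p) (All-resp-⊆ S⊆V V<M))
                 (All-resp-↭ (↭-sym q) (All-resp-⊆ T⊆V V<M)))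
             (cong₂ (λ i j → ⟦ even i ⟧ * Σsel ps (λ a ps′ → ⟦ a ≡ᵇ ⌊ suc j /2⌋ ⟧ * (K u ps′ * ⟦ altUp v ⟧)))
                 (↭-length p) (↭-length q))) ⟩
      Σperm S (λ u → Σperm T (λ v → ⟦ even (length S) ⟧ * Σsel ps (λ a ps′ → δ a * (K u ps′ * ⟦ altUp v ⟧))))
        ≡⟨ trans (Σperm-cong S λ u _ → Σarr-* _ (length T) T _) (Σarr-* _ (length S) S _) ⟩
      ⟦ even (length S) ⟧ * Σperm S (λ u → Σperm T (λ v → Σsel ps (λ a ps′ → δ a * (K u ps′ * ⟦ altUp v ⟧))))
        ≡⟨ cong (⟦ even (length S) ⟧ *_)
            (trans (Σperm-cong S λ u _ → Σsel-swap (Σperm T) (Σarr-0 (length T) T) (Σarr-+ (length T) T) ps _)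
                                                   (Σsel-swap (Σperm S) (Σarr-0 (length S) S)
                                                       (Σarr-+ (length S) S) ps _)) ⟩
      ⟦ even (length S) ⟧ * Σsel ps (λ a ps′ → Σperm S (λ u → Σperm T (λ v → δ a * (K u ps′ * ⟦ altUp v ⟧))))
        ≡⟨ cong (⟦ even (length S) ⟧ *_) (Σsel-cong ps λ a ps′ _ →
            trans (Σperm-× (δ a) S T (λ u → K u ps′) (⟦_⟧ ∘ altUp))
             (cong (λ z → δ a * (recordCount ps′ S * z)) (altCount-length T (descending-⊆ T⊆V V↓)))) ⟩
      ⟦ even (length S) ⟧ * Σsel ps (λ a ps′ → δ a * (recordCount ps′ S * e (length T))) ∎
      where
      δ : ℕ → A
      δ a = ⟦ a ≡ᵇ ⌊ suc (length T) /2⌋ ⟧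
      K : List ℕ → List ℕ → A
      K u ps′ = ⟦ altDown u ⟧ * orderings ps′ (reverse (gapsOf u))

  x^-suc : ∀ a n → x^ a (suc n) ≡ ι a * x^ (pred a) n
  x^-suc zero    n = sym (zeroˡ _)
  x^-suc (suc a) n = refl

  module ClosedForm (x : ℕ → A) (x-def : ∀ c → c ≥ 1 → x c * ι ((2 ℕ.* c) !) ≡ e (pred (2 ℕ.* c))) where

    -- Coefficient j of e(2a-1) x^(2a-1)/(2a-1)!. The assumption on `x` replaces the division:
    -- e(2a-1) = x(a) (2a)! = 2a x(a) (2a-1)!, and (2a-1)! is the diagonal entry of the monomial.
    e-monomial : ∀ a j → a ≥ 1 → odd j ≡ true →
      ⟦ a ≡ᵇ ⌊ suc j /2⌋ ⟧ * e j ≡ ι (2 ℕ.* a) * x a * x^ (pred (2 ℕ.* a)) j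
    e-monomial a j a≥1 odd-j with a ℕ.≟ ⌊ suc j /2⌋
    ... | yes refl = begin
      ⟦ a ≡ᵇ a ⟧ * e j                          ≡⟨ cong₂ (λ b k → ⟦ b ⟧ * e k) (≡ᵇ-refl a) (sym j≡) ⟩
      1# * e (pred (2 ℕ.* a))                   ≡⟨ *-identityˡ _ ⟩
      e (pred (2 ℕ.* a))                        ≡⟨ x-def a a≥1 ⟨
      x a * ι ((2 ℕ.* a) !)                     ≡⟨ cong (λ k → x a * k) (factorial a a≥1) ⟩
      x a * (ι (2 ℕ.* a) * ι (pred (2 ℕ.* a) !)) ≡⟨ rearrange _ _ _ ⟩
      ι (2 ℕ.* a) * x a * ι (pred (2 ℕ.* a) !)   ≡⟨ cong (ι (2 ℕ.* a) * x a *_) (x^-diag (pred (2 ℕ.* a))) ⟨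
      ι (2 ℕ.* a) * x a * x^ (pred (2 ℕ.* a)) (pred (2 ℕ.* a))
          ≡⟨ cong (λ k → ι (2 ℕ.* a) * x a * x^ (pred (2 ℕ.* a)) k) j≡ ⟩
      ι (2 ℕ.* a) * x a * x^ (pred (2 ℕ.* a)) j ∎
      where
      j≡ = ⌊suc-odd/2⌋ j odd-j
      factorial : ∀ a → a ≥ 1 → ι ((2 ℕ.* a) !) ≡ ι (2 ℕ.* a) * ι (pred (2 ℕ.* a) !)
      factorial (suc a) _ = ι-* (2 ℕ.* suc a) (pred (2 ℕ.* suc a) !)
      rearrange : ∀ a b c → a * (b * c) ≡ b * a * c
      rearrange = solve 3 (λ a b c → a :* (b :* c) := b :* a :* c) refl
    ... | no  a≢c    = begin
      ⟦ a ≡ᵇ ⌊ suc j /2⌋ ⟧ * e j                ≡⟨ cong (λ b → ⟦ b ⟧ * e j) (≢⇒≡ᵇ-false a≢c) ⟩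
      0# * e j                                  ≡⟨ zeroˡ _ ⟩
      0#                                        ≡⟨ zeroʳ _ ⟨
      ι (2 ℕ.* a) * x a * 0#
          ≡⟨ cong (ι (2 ℕ.* a) * x a *_) (x^-off (pred (2 ℕ.* a)) j (a≢c ∘ halve a a≥1)) ⟨
      ι (2 ℕ.* a) * x a * x^ (pred (2 ℕ.* a)) j ∎
      where
      halve : ∀ a → a ≥ 1 → pred (2 ℕ.* a) ≡ j → a ≡ ⌊ suc j /2⌋
      halve (suc a) _ refl = trans (ℕ.n≡⌊n+n/2⌋ (suc a))
          (cong (λ k → ⌊ suc a ℕ.+ k /2⌋) (sym (ℕ.+-identityʳ (suc a))))

    recordCount-formula : ∀ ps V → All (_≥ 1) ps → Descending V → even (length V) ≡ true →
      recordCount ps V ≡ x^ (2 ℕ.* sum ps) (length V) * Πlist ps x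
    recordCount-formula ps V = go (length V) ps V ℕ.≤-refl
      where
      go : ∀ n ps V → length V ≤ n → All (_≥ 1) ps → Descending V → even (length V) ≡ true →
        recordCount ps V ≡ x^ (2 ℕ.* sum ps) (length V) * Πlist ps x
      go n []           [] _ _           _ _ = refl
      go n (suc c ∷ ps) [] _ (_ ∷ _)     _ _ = trans (zeroʳ _) (sym (zeroˡ _))
      go n (zero ∷ ps)  [] _ (() ∷ _)    _ _
      go (suc n) ps (M ∷ V) (s≤s V≤n) ps≥1 (V<M ∷ V↓) odd-V = begin
        recordCount ps (M ∷ V)
          ≡⟨ recordCount-∷ ps V V<M V↓ ⟩
        Σsplit V (λ S T → ⟦ even (length S) ⟧ *
            Σsel ps (λ a ps′ → ⟦ a ≡ᵇ ⌊ suc (length T) /2⌋ ⟧ * (recordCount ps′ S * e (length T))))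
          ≡⟨ Σsplit-cong V by-length ⟩
        Σsplit V (λ S T → Σsel ps (λ a ps′ → ι (2 ℕ.* a) * Πlist ps x *
            (x^ (2 ℕ.* sum ps′) (length S) * x^ (pred (2 ℕ.* a)) (length T))))
          ≡⟨ Σsplit-length V (λ i j → Σsel ps (λ a ps′ → ι (2 ℕ.* a) * Πlist ps x *
              (x^ (2 ℕ.* sum ps′) i * x^ (pred (2 ℕ.* a)) j))) ⟩
        shuffle (λ i j → Σsel ps (λ a ps′ → ι (2 ℕ.* a) * Πlist ps x *
            (x^ (2 ℕ.* sum ps′) i * x^ (pred (2 ℕ.* a)) j))) l
          ≡⟨ Σsel-swap (λ F → shuffle (λ i j → F (i , j)) l) (shuffle-0 l) (λ F G → shuffle-+ _ _ l) ps _ ⟩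
        Σsel ps (λ a ps′ → shuffle (λ i j → ι (2 ℕ.* a) * Πlist ps x *
            (x^ (2 ℕ.* sum ps′) i * x^ (pred (2 ℕ.* a)) j)) l)
          -- Whichever part is removed, the two monomials multiply to the same power of x, so that
          -- only the factor 2a still depends on `a`.
          ≡⟨ Σsel-cong ps (λ a ps′ p → trans (shuffle-* _ _ l) (trans (cong (ι (2 ℕ.* a) * Πlist ps x *_)
               (trans (x^-+ (2 ℕ.* sum ps′) (pred (2 ℕ.* a)) l) (cong (λ k → x^ k l) (degree a ps′ p))))
                   (rearrange _ _ _))) ⟩
        Σsel ps (λ a ps′ → Πlist ps x * x^ (pred (2 ℕ.* sum ps)) l * ι (2 ℕ.* a))
          ≡⟨ trans (Σsel-* _ ps _) (cong (Πlist ps x * x^ (pred (2 ℕ.* sum ps)) l *_)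
              (trans (Σsel-const ps (λ a → ι (2 ℕ.* a))) (total ps))) ⟩
        Πlist ps x * x^ (pred (2 ℕ.* sum ps)) l * ι (2 ℕ.* sum ps)
          ≡⟨ rearrange′ _ _ _ ⟩
        ι (2 ℕ.* sum ps) * x^ (pred (2 ℕ.* sum ps)) l * Πlist ps x
          ≡⟨ cong (_* Πlist ps x) (x^-suc (2 ℕ.* sum ps) l) ⟨
        x^ (2 ℕ.* sum ps) (suc l) * Πlist ps x ∎
        where
        l = length V

        rearrange : ∀ a b c → a * b * c ≡ b * c * a
        rearrange = solve 3 (λ a b c → a :* b :* c := b :* c :* a) refl
        rearrange′ : ∀ a b c → a * b * c ≡ c * b * a
        rearrange′ = solve 3 (λ a b c → a :* b :* c := c :* b :* a) refl

        total : ∀ ps → Σlist ps (λ a → ι (2 ℕ.* a)) ≡ ι (2 ℕ.* sum ps)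
        total []       = refl
        total (a ∷ ps) = trans (cong (ι (2 ℕ.* a) +_) (total ps))
          (trans (sym (ι-+ (2 ℕ.* a) (2 ℕ.* sum ps))) (cong ι (sym (ℕ.*-distribˡ-+ 2 a (sum ps)))))

        degree : ∀ a ps′ → ps ↭ a ∷ ps′ → 2 ℕ.* sum ps′ ℕ.+ pred (2 ℕ.* a) ≡ pred (2 ℕ.* sum ps)
        degree a ps′ p with a≥1 ∷ _ ← All-resp-↭ p ps≥1 = step a a≥1 (sum-↭ p)
          where
          step : ∀ a → a ≥ 1 → sum ps ≡ a ℕ.+ sum ps′ → 2 ℕ.* sum ps′ ℕ.+ pred (2 ℕ.* a) ≡ pred (2 ℕ.* sum ps)
          step (suc a) _ eq rewrite eq = trans (ℕ.+-comm (2 ℕ.* sum ps′) _)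
              (cong pred (sym (ℕ.*-distribˡ-+ 2 (suc a) (sum ps′))))

        by-length : ∀ S T → S ⊆ V → T ⊆ V → length S ℕ.+ length T ≡ l →
          ⟦ even (length S) ⟧ * Σsel ps (λ a ps′ → ⟦ a ≡ᵇ ⌊ suc (length T) /2⌋ ⟧ *
              (recordCount ps′ S * e (length T))) ≡
          Σsel ps (λ a ps′ → ι (2 ℕ.* a) * Πlist ps x *
              (x^ (2 ℕ.* sum ps′) (length S) * x^ (pred (2 ℕ.* a)) (length T)))
        by-length S T S⊆V T⊆V S+T with even (length S) in parity
        -- For odd |S| the right side vanishes without a parity factor, because |S| cannot equal the
        -- even exponent `2 ℕ.* sum ps′`.
        ... | false = trans (zeroˡ _) (sym (trans (Σsel-cong ps λ a ps′ _ →
          trans (cong (λ z → ι (2 ℕ.* a) * Πlist ps x * (z * x^ (pred (2 ℕ.* a)) (length T)))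
              (x^-off (2 ℕ.* sum ps′) (length S) (odd≢ ps′)))
            (trans (cong (ι (2 ℕ.* a) * Πlist ps x *_) (zeroˡ _)) (zeroʳ _))) (Σsel-0 ps)))
          where
          odd≢ : ∀ ps′ → 2 ℕ.* sum ps′ ≢ length S
          odd≢ ps′ eq with () ← trans (sym parity) (trans (cong even (sym eq)) (even-2* (sum ps′)))
        ... | true  = trans (*-identityˡ _) (Σsel-cong ps term)
          where
          odd-T : odd (length T) ≡ true
          odd-T = even-odd-+ (length S) (length T) parity (trans (cong odd S+T) odd-V)
          S≤n : length S ≤ n
          S≤n = ℕ.≤-trans (ℕ.≤-trans (ℕ.m≤m+n _ _) (ℕ.≤-reflexive S+T)) V≤n
          reorder : ∀ d r p e → d * ((r * p) * e) ≡ (d * e) * (r * p)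
          reorder = solve 4 (λ d r p e → d :* ((r :* p) :* e) := (d :* e) :* (r :* p)) refl
          reorder′ : ∀ i x m r p → (i * x * m) * (r * p) ≡ i * (x * p) * (r * m)
          reorder′ = solve 5 (λ i x m r p → (i :* x :* m) :* (r :* p) := i :* (x :* p) :* (r :* m)) refl
          term : ∀ a ps′ → ps ↭ a ∷ ps′ →
            ⟦ a ≡ᵇ ⌊ suc (length T) /2⌋ ⟧ * (recordCount ps′ S * e (length T)) ≡
            ι (2 ℕ.* a) * Πlist ps x * (x^ (2 ℕ.* sum ps′) (length S) * x^ (pred (2 ℕ.* a)) (length T))
          term a ps′ p with a≥1 ∷ ps′≥1 ← All-resp-↭ p ps≥1 = begin
            δ * (recordCount ps′ S * e (length T))
              ≡⟨ cong (λ z → δ * (z * e (length T))) (go n ps′ S S≤n ps′≥1 (descending-⊆ S⊆V V↓) parity) ⟩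
            δ * ((x^ (2 ℕ.* sum ps′) (length S) * Πlist ps′ x) * e (length T))
              ≡⟨ reorder _ _ _ _ ⟩
            (δ * e (length T)) * (x^ (2 ℕ.* sum ps′) (length S) * Πlist ps′ x)
              ≡⟨ cong (_* (x^ (2 ℕ.* sum ps′) (length S) * Πlist ps′ x)) (e-monomial a (length T) a≥1 odd-T) ⟩
            (ι (2 ℕ.* a) * x a * x^ (pred (2 ℕ.* a)) (length T)) * (x^ (2 ℕ.* sum ps′) (length S) * Πlist ps′ x)
              ≡⟨ reorder′ _ _ _ _ _ ⟩
            ι (2 ℕ.* a) * (x a * Πlist ps′ x) * (x^ (2 ℕ.* sum ps′) (length S) * x^ (pred (2 ℕ.* a)) (length T))
              ≡⟨ cong (λ z → ι (2 ℕ.* a) * z * (x^ (2 ℕ.* sum ps′) (length S) * x^ (pred (2 ℕ.* a)) (length T)))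
                  (Πlist-↭ x p) ⟨
            ι (2 ℕ.* a) * Πlist ps x * (x^ (2 ℕ.* sum ps′) (length S) * x^ (pred (2 ℕ.* a)) (length T)) ∎
            where δ = ⟦ a ≡ᵇ ⌊ suc (length T) /2⌋ ⟧

  -- From distinguished parts to multiplicities

  Πlist-mult : ∀ {ks c} (h : ℕ → ℕ → A) {y} g → Unique ks → c ∈ ks → h c (suc (mult c g)) ≡ y * h c (mult c g) →
    Πlist ks (λ k → h k (mult k (c ∷ g))) ≡ y * Πlist ks (λ k → h k (mult k g))
  Πlist-mult {c = c} h g ks! c∈ks eq = Πlist-unique ks! c∈ks
    (trans (cong (h c) (mult-same c g)) eq) (λ k c≢k → cong (h k) (mult-other g c≢k))

  factorials : List ℕ → List ℕ → A
  factorials ks g = Πlist ks (λ k → ι (mult k g !))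

  -- The head `c` can be taken from each of its places in `ps`, and the rest contributes the same
  -- number every time. So each copy of `c` multiplies by the multiplicity reached so far, which
  -- builds up ∏ mₖ!.
  orderings-↭ : ∀ {ks} ps r → Unique ks → All (_∈ ks) r → r ↭ ps → orderings ps r ≡ factorials ks r
  orderings-↭ {ks} ps [] ks! _ p with refl ← ↭-empty-inv (↭-sym p) =
    sym (trans (Πlist-cong ks (λ _ → +-identityʳ 1#)) (Πlist-1 ks))
  orderings-↭ {ks} ps (c ∷ r) ks! (c∈ks ∷ r∈ks) p = begin
    Σsel ps (λ a ps′ → ⟦ a ≡ᵇ c ⟧ * orderings ps′ r)
      ≡⟨ Σsel-cong ps remove ⟩
    Σsel ps (λ a _ → factorials ks r * ⟦ a ≡ᵇ c ⟧)
      ≡⟨ trans (Σsel-* _ ps _) (cong (factorials ks r *_) (Σsel-const ps (λ a → ⟦ a ≡ᵇ c ⟧))) ⟩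
    factorials ks r * Σlist ps (λ a → ⟦ a ≡ᵇ c ⟧)
      ≡⟨ cong (factorials ks r *_) (trans (sym (Σlist-filter (_≡ᵇ c) ps))
          (cong ι (trans (mult-↭ c (↭-sym p)) (mult-same c r)))) ⟩
    factorials ks r * ι (suc (mult c r))
      ≡⟨ *-comm _ _ ⟩
    ι (suc (mult c r)) * factorials ks r
      ≡⟨ Πlist-mult (λ _ m → ι (m !)) r ks! c∈ks (ι-* (suc (mult c r)) (mult c r !)) ⟨
    factorials ks (c ∷ r) ∎
    where
    remove : ∀ a ps′ → ps ↭ a ∷ ps′ → ⟦ a ≡ᵇ c ⟧ * orderings ps′ r ≡ factorials ks r * ⟦ a ≡ᵇ c ⟧
    remove a ps′ q with a ℕ.≟ c
    ... | yes refl = trans (cong (⟦ a ≡ᵇ a ⟧ *_) (orderings-↭ ps′ r ks! r∈ks (drop-∷ (↭-trans p q)))) (*-comm _ _)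
    ... | no  a≢c rewrite ≢⇒≡ᵇ-false a≢c = trans (zeroˡ _) (sym (zeroʳ _))

  orderings-¬↭ : ∀ ps r → ¬ (r ↭ ps) → orderings ps r ≡ 0#
  orderings-¬↭ []       []      ¬p = contradiction ↭-refl ¬p
  orderings-¬↭ (_ ∷ _)  []      ¬p = refl
  orderings-¬↭ ps       (c ∷ r) ¬p = trans (Σsel-cong ps remove) (Σsel-0 ps)
    where
    remove : ∀ a ps′ → ps ↭ a ∷ ps′ → ⟦ a ≡ᵇ c ⟧ * orderings ps′ r ≡ 0#
    remove a ps′ q with a ℕ.≟ c
    ... | yes refl = trans (cong (⟦ a ≡ᵇ a ⟧ *_) (orderings-¬↭ ps′ r λ p → ¬p (↭-trans (prep a p) (↭-sym q))))
        (zeroʳ _)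
    ... | no  a≢c rewrite ≢⇒≡ᵇ-false a≢c = zeroˡ _

  -- The gaps can be labelled by `ps` only if they sort to `ps`, and the number of labellings is
  -- then independent of the word.
  orderings-reverse : ∀ {ks} ps g → Unique ks → All (_∈ ks) ps → Linked _≥_ ps →
    orderings ps (reverse g) ≡ factorials ks ps * ⟦ ⌊ ≡-dec ℕ._≟_ (sortDesc g) ps ⌋ ⟧
  orderings-reverse {ks} ps g ks! ps∈ks ps↓ with ≡-dec ℕ._≟_ (sortDesc g) ps
  ... | yes eq = begin
    orderings ps (reverse g)      ≡⟨ orderings-↭ ps (reverse g) ks! (All-resp-↭ (↭-sym p) ps∈ks) p ⟩
    factorials ks (reverse g)     ≡⟨ Πlist-cong ks (λ k → cong (λ m → ι (m !)) (mult-↭ k p)) ⟩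
    factorials ks ps              ≡⟨ *-identityʳ _ ⟨
    factorials ks ps * 1#         ∎
    where
    p : reverse g ↭ ps
    p = ↭-trans (↭-reverse g) (subst (g ↭_) eq (↭-sym (sortDesc-↭ g)))
  ... | no neq = trans
    (orderings-¬↭ ps (reverse g) λ p → neq (↭⇒sortDesc≡ ps↓ (↭-trans (↭-sym (↭-reverse g)) p)))
    (sym (zeroʳ _))

  module S-Solver = SemiringSolver seriesSemiring
  open S-Solver using () renaming (_:=_ to _S:=_; _:+_ to _S:+_; _:*_ to _S:*_)

  -- Hyperbolic tangent and Bernoulli numbers

  ⊛-cong-≤ : ∀ {f f′} g n → (∀ k → k ≤ n → f k ≡ f′ k) → (f ⊛ g) n ≡ (f′ ⊛ g) n
  ⊛-cong-≤ g n eq = shuffle-cong n λ i j i+j≡n → cong (_* g j) (eq i (ℕ.≤-trans (ℕ.m≤m+n i j) (ℕ.≤-reflexive i+j≡n)))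

  -- If f and g agree below n, the next two coefficients of f ⊛ h and g ⊛ h differ only in
  -- their leading terms; each equation is arranged so that no subtraction occurs.
  ⊛-lead : ∀ {f g} h n → (∀ k → k < n → f k ≡ g k) → (f ⊛ h) n + g n * h 0 ≡ (g ⊛ h) n + f n * h 0
  ⊛-lead h zero    eq = +-comm _ _
  ⊛-lead {f} {g} h (suc n) eq = begin
    (f ∘ suc ⊛ h) n + (f ⊛ (h ∘ suc)) n + g (suc n) * h 0 ≡⟨ swap₂ _ _ _ ⟩
    (f ∘ suc ⊛ h) n + g (suc n) * h 0 + (f ⊛ (h ∘ suc)) n
      ≡⟨ cong₂ _+_ (⊛-lead {f ∘ suc} {g ∘ suc} h n λ k k<n → eq (suc k) (s≤s k<n))
          (⊛-cong-≤ (h ∘ suc) n λ k k≤n → eq k (s≤s k≤n)) ⟩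
    (g ∘ suc ⊛ h) n + f (suc n) * h 0 + (g ⊛ (h ∘ suc)) n ≡⟨ swap₂ _ _ _ ⟨
    (g ∘ suc ⊛ h) n + (g ⊛ (h ∘ suc)) n + f (suc n) * h 0 ∎
    where
    swap₂ : ∀ a b c → a + b + c ≡ a + c + b
    swap₂ = solve 3 (λ a b c → a :+ b :+ c := a :+ c :+ b) refl

  ⊛-lead₂ : ∀ {f g} h n → (∀ k → k < n → f k ≡ g k) →
    (f ⊛ h) (suc n) + (g (suc n) * h 0 + ι (suc n) * g n * h 1) ≡
    (g ⊛ h) (suc n) + (f (suc n) * h 0 + ι (suc n) * f n * h 1)
  ⊛-lead₂ {f} {g} h zero eq rewrite +-identityʳ 1# | *-identityˡ (f 0) | *-identityˡ (g 0) = +-comm _ _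
  ⊛-lead₂ {f} {g} h (suc n) eq = begin
    (f ∘ suc ⊛ h) (suc n) + (f ⊛ (h ∘ suc)) (suc n) + (g (suc (suc n)) * h 0 + ι (suc (suc n)) * g (suc n) * h 1)
      ≡⟨ regroup _ _ _ _ _ _ _ ⟩
    ((f ∘ suc ⊛ h) (suc n) + (g (suc (suc n)) * h 0 + ι (suc n) * g (suc n) * h 1)) +
        ((f ⊛ (h ∘ suc)) (suc n) + g (suc n) * h 1)
      ≡⟨ cong₂ _+_ (⊛-lead₂ {f ∘ suc} {g ∘ suc} h n λ k k<n → eq (suc k) (s≤s k<n))
          (⊛-lead {f} {g} (h ∘ suc) (suc n) eq) ⟩
    ((g ∘ suc ⊛ h) (suc n) + (f (suc (suc n)) * h 0 + ι (suc n) * f (suc n) * h 1)) +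
        ((g ⊛ (h ∘ suc)) (suc n) + f (suc n) * h 1)
      ≡⟨ regroup _ _ _ _ _ _ _ ⟨
    (g ∘ suc ⊛ h) (suc n) + (g ⊛ (h ∘ suc)) (suc n) + (f (suc (suc n)) * h 0 + ι (suc (suc n)) * f (suc n) * h 1) ∎
    where
    regroup : ∀ a b p q i r s → a + b + (p * q + (1# + i) * r * s) ≡ (a + (p * q + i * r * s)) + (b + r * s)
    regroup = solve 7 (λ a b p q i r s →
      a :+ b :+ (p :* q :+ (A-Solver.con 1 :+ i) :* r :* s) := (a :+ (p :* q :+ i :* r :* s)) :+ (b :+ r :* s)) refl

  xₛ exp : Series
  xₛ zero    = 0#
  xₛ (suc n) = 1ₛ n
  exp _ = 1#

  xₛ-⊛ : ∀ f n → (xₛ ⊛ f) (suc n) ≡ ι (suc n) * f n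
  xₛ-⊛ f zero    = begin
    1# * f 0 + 0# * f 1   ≡⟨ cong₂ _+_ refl (zeroˡ _) ⟩
    1# * f 0 + 0#         ≡⟨ +-identityʳ _ ⟩
    1# * f 0              ≡⟨ cong (_* f 0) (+-identityʳ 1#) ⟨
    (1# + 0#) * f 0       ∎
  xₛ-⊛ f (suc n) = begin
    (1ₛ ⊛ f) (suc n) + (xₛ ⊛ (f ∘ suc)) (suc n)   ≡⟨ cong₂ _+_ (⊛-identityˡ f (suc n)) (xₛ-⊛ (f ∘ suc) n) ⟩
    f (suc n) + ι (suc n) * f (suc n)             ≡⟨ cong (_+ ι (suc n) * f (suc n)) (*-identityˡ _) ⟨
    1# * f (suc n) + ι (suc n) * f (suc n)        ≡⟨ distribʳ _ _ _ ⟨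
    (1# + ι (suc n)) * f (suc n)                  ∎

  -- double f is f(2x).
  double : Series → Series
  double f n = ι (2 ℕ.^ n) * f n

  double-cong : ∀ {f g} → f ≗ g → double f ≗ double g
  double-cong eq n = cong (ι (2 ℕ.^ n) *_) (eq n)

  double-suc : ∀ f n → double f (suc n) ≡ ι 2 * double (f ∘ suc) n
  double-suc f n = trans (cong (_* f (suc n)) (ι-* 2 (2 ℕ.^ n))) (*-assoc _ _ _)

  double-⊕ : ∀ f g → double (f ⊕ g) ≗ double f ⊕ double g
  double-⊕ f g n = distribˡ _ _ _

  double-⊛ : ∀ f g → double (f ⊛ g) ≗ double f ⊛ double g
  double-⊛ f g zero = trans (ι1* (f 0 * g 0)) (sym (cong₂ _*_ (ι1* (f 0)) (ι1* (g 0))))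
    where
    ι1* : ∀ a → ι 1 * a ≡ a
    ι1* a = trans (cong (_* a) (+-identityʳ 1#)) (*-identityˡ a)
  double-⊛ f g (suc n) = begin
    double (f ⊛ g) (suc n)
      ≡⟨ double-suc (f ⊛ g) n ⟩
    ι 2 * double (f ∘ suc ⊛ g ⊕ f ⊛ (g ∘ suc)) n
      ≡⟨ cong (ι 2 *_) (trans (double-⊕ (f ∘ suc ⊛ g) (f ⊛ (g ∘ suc)) n)
          (cong₂ _+_ (double-⊛ (f ∘ suc) g n) (double-⊛ f (g ∘ suc) n))) ⟩
    ι 2 * ((double (f ∘ suc) ⊛ double g) n + (double f ⊛ double (g ∘ suc)) n)
      ≡⟨ distribˡ _ _ _ ⟩
    ι 2 * (double (f ∘ suc) ⊛ double g) n + ι 2 * (double f ⊛ double (g ∘ suc)) n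
      ≡⟨ cong₂ _+_ (trans (⊛-cong {g = double g} (double-suc f) (λ _ → refl) n) (⊛-*ˡ (ι 2) _ _ n))
                   (trans (⊛-cong {f = double f} (λ _ → refl) (double-suc g) n) (⊛-*ʳ (ι 2) _ _ n)) ⟨
    (double f ⊛ double g) (suc n) ∎

  -- The series e^(2x); `double E` is e^(4x).
  E : Series
  E = double exp

  exp-⊛-exp : exp ⊛ exp ≗ E
  exp-⊛-exp zero    = cong (_* 1#) (sym (+-identityʳ 1#))
  exp-⊛-exp (suc n) = begin
    (exp ⊛ exp) n + (exp ⊛ exp) n          ≡⟨ cong₂ _+_ (exp-⊛-exp n) (exp-⊛-exp n) ⟩
    ι (2 ℕ.^ n) * 1# + ι (2 ℕ.^ n) * 1#    ≡⟨ distribʳ _ _ _ ⟨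
    (ι (2 ℕ.^ n) + ι (2 ℕ.^ n)) * 1#       ≡⟨ cong (_* 1#) (ι-+ (2 ℕ.^ n) (2 ℕ.^ n)) ⟨
    ι (2 ℕ.^ n ℕ.+ 2 ℕ.^ n) * 1#           ≡⟨ cong (λ k → ι (2 ℕ.^ n ℕ.+ k) * 1#) (ℕ.+-identityʳ (2 ℕ.^ n)) ⟨
    E (suc n) ∎

  E-suc : E ∘ suc ≗ E ⊕ E
  E-suc n = trans (cong (_* 1#) (trans (cong ι (cong (2 ℕ.^ n ℕ.+_) (ℕ.+-identityʳ (2 ℕ.^ n))))
      (ι-+ (2 ℕ.^ n) (2 ℕ.^ n)))) (distribʳ _ _ _)

  double-E : double E ≗ E ⊛ E
  double-E n = trans (double-cong (λ k → sym (exp-⊛-exp k)) n) (double-⊛ exp exp n)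

  double-xₛ : double xₛ ≗ xₛ ⊕ xₛ
  double-xₛ zero          = trans (zeroʳ _) (sym (+-identityʳ 0#))
  double-xₛ (suc zero)    = trans (*-identityʳ _) (cong (1# +_) (+-identityʳ 1#))
  double-xₛ (suc (suc n)) = trans (zeroʳ _) (sym (+-identityʳ 0#))

  module WithCancellation
    (+-cancelʳ : ∀ a {b c} → b + a ≡ c + a → b ≡ c)
    (ι-cancelˡ : ∀ n {a b} → ι (suc n) * a ≡ ι (suc n) * b → a ≡ b) where

    -- Cancellation of e^(4x) - 1 without subtraction. That series starts with 4x, so coefficient n
    -- + 1 of its product with f is 4 (n + 1) f(n) plus terms in earlier coefficients of f.
    E²-cancel : ∀ f g → f ⊛ (E ⊛ E) ⊕ g ≗ g ⊛ (E ⊛ E) ⊕ f → f ≗ g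
    E²-cancel f g eq n = below (suc n) n ℕ.≤-refl
      where
      F : Series
      F = E ⊛ E
      F₀ : F 0 ≡ 1#
      F₀ = trans (cong₂ _*_ (trans (*-identityʳ _) (+-identityʳ 1#)) (trans (*-identityʳ _) (+-identityʳ 1#)))
          (*-identityˡ 1#)
      F₁ : F 1 ≡ ι 4
      F₁ = trans (sym (double-E 1)) (trans (cong (ι 2 *_) (*-identityʳ (ι 2))) (sym (ι-* 2 2)))
      next : ∀ n → (∀ k → k < n → f k ≡ g k) → f n ≡ g n
      -- The outer cancellation removes n + 1; the inner one, with argument 3, removes 4 = `F 1`.
      next n f≡g = ι-cancelˡ n (ι-cancelˡ 3 (trans (*-comm _ _) (trans
        (cong (ι (suc n) * f n *_) (sym F₁))
            (trans (sym g*F₁≡f*F₁) (trans (cong (ι (suc n) * g n *_) F₁) (*-comm _ _))))))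
        where
        swap₂ : ∀ a b c → a + (b + c) ≡ c + (a + b)
        swap₂ = solve 3 (λ a b c → a :+ (b :+ c) := c :+ (a :+ b)) refl
        g*F₁≡f*F₁ : ι (suc n) * g n * F 1 ≡ ι (suc n) * f n * F 1
        g*F₁≡f*F₁ = +-cancelʳ ((f ⊛ F) (suc n) + g (suc n)) (begin
          ι (suc n) * g n * F 1 + ((f ⊛ F) (suc n) + g (suc n))
            ≡⟨ swap₂ _ _ _ ⟨
          (f ⊛ F) (suc n) + (g (suc n) + ι (suc n) * g n * F 1)
            ≡⟨ cong (λ z → (f ⊛ F) (suc n) + (z + ι (suc n) * g n * F 1))
                (trans (cong (g (suc n) *_) F₀) (*-identityʳ _)) ⟨
          (f ⊛ F) (suc n) + (g (suc n) * F 0 + ι (suc n) * g n * F 1)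
            ≡⟨ ⊛-lead₂ {f} {g} F n f≡g ⟩
          (g ⊛ F) (suc n) + (f (suc n) * F 0 + ι (suc n) * f n * F 1)
            ≡⟨ cong (λ z → (g ⊛ F) (suc n) + (z + ι (suc n) * f n * F 1))
                (trans (cong (f (suc n) *_) F₀) (*-identityʳ _)) ⟩
          (g ⊛ F) (suc n) + (f (suc n) + ι (suc n) * f n * F 1)
            ≡⟨ swap₂ _ _ _ ⟩
          ι (suc n) * f n * F 1 + ((g ⊛ F) (suc n) + f (suc n))
            ≡⟨ cong (ι (suc n) * f n * F 1 +_) (eq (suc n)) ⟨
          ι (suc n) * f n * F 1 + ((f ⊛ F) (suc n) + g (suc n)) ∎)
      below : ∀ n k → k < n → f k ≡ g k
      below (suc n) k (s≤s k≤n) with ℕ.m≤n⇒m<n∨m≡n k≤n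
      ... | inj₁ k<n  = below n k k<n
      ... | inj₂ refl = next n (below n)

    -- T solves the Riccati equation T′ + T² = 1 of the hyperbolic tangent, and B eˣ = B + x.
    module _ (T : Series) (T-0 : T 0 ≡ 0#) (T-suc : T ∘ suc ⊕ T ⊛ T ≗ 1ₛ)
             (B : Series) (B-exp : B ⊛ exp ≗ B ⊕ xₛ) where

      -- The difference D = L - E satisfies D′ = (1 - T) D and D(0) = 0, so it vanishes coefficient
      -- by coefficient; `ode` is this equation with the negative terms moved across.
      T-E : T ⊛ E ⊕ T ⊕ 1ₛ ≗ E
      T-E n = agree n n ℕ.≤-refl
        where
        L : Series
        L = T ⊛ E ⊕ T ⊕ 1ₛ
        ode : ∀ n → L (suc n) + (T ⊛ L) n + E n ≡ E (suc n) + (T ⊛ E) n + L n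
        ode n = begin
          L (suc n) + (T ⊛ L) n + E n
            ≡⟨ cong (λ z → z + (T ⊛ L) n +
                E n) (trans (+-identityʳ _)
                (cong (λ z → (T ∘ suc ⊛ E) n + z + T (suc n)) (⊛-cong {f = T} (λ _ → refl) E-suc n))) ⟩
          (T ∘ suc ⊛ E ⊕ T ⊛ (E ⊕ E) ⊕ T ∘ suc ⊕ T ⊛ (T ⊛ E ⊕ T ⊕ 1ₛ) ⊕ E) n
            ≡⟨ S-Solver.solve 3 (λ t′ t e → t′ S:* e S:+ t S:* (e S:+ e) S:+ t′ S:+
                t S:* (t S:* e S:+ t S:+ S-Solver.con 1) S:+ e
                 S:= (t′ S:+ t S:* t) S:* (e S:+ S-Solver.con 1) S:+ t S:* e S:+ t S:* e S:+ t S:+ e) (λ _ →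
                     refl) (T ∘ suc) T E n ⟩
          ((T ∘ suc ⊕ T ⊛ T) ⊛ (E ⊕ 1ₛ) ⊕ T ⊛ E ⊕ T ⊛ E ⊕ T ⊕ E) n
            ≡⟨ cong (λ z → z + (T ⊛ E) n + (T ⊛ E) n + T n + E n) (⊛-cong {g = E ⊕ 1ₛ} T-suc (λ _ → refl) n) ⟩
          (1ₛ ⊛ (E ⊕ 1ₛ) ⊕ T ⊛ E ⊕ T ⊛ E ⊕ T ⊕ E) n
            ≡⟨ S-Solver.solve 2 (λ t e → S-Solver.con 1 S:* (e S:+ S-Solver.con 1) S:+ t S:* e S:+ t S:* e S:+ t S:+ e
                 S:= (e S:+ e) S:+ t S:* e S:+ (t S:* e S:+ t S:+ S-Solver.con 1)) (λ _ → refl) T E n ⟩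
          ((E ⊕ E) ⊕ T ⊛ E ⊕ (T ⊛ E ⊕ T ⊕ 1ₛ)) n
            ≡⟨ cong (λ z → z + (T ⊛ E) n + L n) (E-suc n) ⟨
          E (suc n) + (T ⊛ E) n + L n ∎
        next : ∀ n → (∀ k → k ≤ n → L k ≡ E k) → L (suc n) ≡ E (suc n)
        next n L≡E = +-cancelʳ ((T ⊛ E) n) (+-cancelʳ (E n) (begin
          L (suc n) + (T ⊛ E) n + E n ≡⟨ cong (λ z → L (suc n) + z +
              E n) (trans (⊛-comm T E n) (trans (sym (⊛-cong-≤ T n L≡E)) (⊛-comm L T n))) ⟩
          L (suc n) + (T ⊛ L) n + E n ≡⟨ ode n ⟩
          E (suc n) + (T ⊛ E) n + L n ≡⟨ cong (E (suc n) + (T ⊛ E) n +_) (L≡E n ℕ.≤-refl) ⟩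
          E (suc n) + (T ⊛ E) n + E n ∎))
        L₀ : L 0 ≡ E 0
        L₀ = begin
          T 0 * E 0 + T 0 + 1#  ≡⟨ cong (λ z → z * E 0 + z + 1#) T-0 ⟩
          0# * E 0 + 0# + 1#    ≡⟨ cong (_+ 1#) (trans (+-identityʳ _) (zeroˡ _)) ⟩
          0# + 1#               ≡⟨ +-comm 0# 1# ⟩
          1# + 0#               ≡⟨ *-identityʳ _ ⟨
          E 0                   ∎
        agree : ∀ n k → k ≤ n → L k ≡ E k
        agree n       zero    _       = L₀
        agree (suc n) (suc k) (s≤s k≤n) = next k (λ j j≤k → agree n j (ℕ.≤-trans j≤k k≤n))

      -- With `B` as b these are b(2x) and b(4x), so P (E - 1) = 2x and Q (E² - 1) = 4x.
      P Q : Series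
      P = double B
      Q = double P

      P-E : P ⊛ E ≗ P ⊕ (xₛ ⊕ xₛ)
      P-E n = trans (sym (double-⊛ B exp n))
          (trans (double-cong B-exp n) (trans (double-⊕ B xₛ n) (cong (P n +_) (double-xₛ n))))

      Q-E² : Q ⊛ (E ⊛ E) ≗ Q ⊕ ((xₛ ⊕ xₛ) ⊕ (xₛ ⊕ xₛ))
      Q-E² n = begin
        (Q ⊛ (E ⊛ E)) n                 ≡⟨ ⊛-cong {f = Q} (λ _ → refl) double-E n ⟨
        (Q ⊛ double E) n                ≡⟨ double-⊛ P E n ⟨
        double (P ⊛ E) n                ≡⟨ double-cong P-E n ⟩
        double (P ⊕ (xₛ ⊕ xₛ)) n        ≡⟨ trans (double-⊕ P (xₛ ⊕ xₛ) n)
            (cong (Q n +_) (trans (double-⊕ xₛ xₛ n) (cong₂ _+_ (double-xₛ n) (double-xₛ n)))) ⟩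
        (Q ⊕ ((xₛ ⊕ xₛ) ⊕ (xₛ ⊕ xₛ))) n ∎

      -- This is T (E + 1) = E - 1 multiplied by E - 1, that is, T (E² - 1) = (E - 1)².
      T-E² : T ⊛ (E ⊛ E) ⊕ E ⊕ E ≗ E ⊛ E ⊕ T ⊕ 1ₛ
      T-E² n = begin
        (T ⊛ (E ⊛ E) ⊕ E ⊕ E) n
          ≡⟨ cong (λ z → (T ⊛ (E ⊛ E)) n + z + E n) (T-E n) ⟨
        (T ⊛ (E ⊛ E) ⊕ (T ⊛ E ⊕ T ⊕ 1ₛ) ⊕ E) n
          ≡⟨ S-Solver.solve 2 (λ t e → t S:* (e S:* e) S:+ (t S:* e S:+ t S:+ S-Solver.con 1) S:+ e
               S:= (t S:* e S:+ t S:+ S-Solver.con 1) S:* e S:+ t S:+ S-Solver.con 1) (λ _ → refl) T E n ⟩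
        ((T ⊛ E ⊕ T ⊕ 1ₛ) ⊛ E ⊕ T ⊕ 1ₛ) n
          ≡⟨ cong (λ z → z + T n + 1ₛ n) (⊛-cong {g = E} T-E (λ _ → refl) n) ⟩
        (E ⊛ E ⊕ T ⊕ 1ₛ) n ∎

      -- Multiplied by E² - 1, the left side is x (E - 1)² + 2x (E + 1) and the right side is x (E²
      -- - 1) + 4x; both equal x (E² + 3).
      x-T : xₛ ⊛ T ⊕ P ≗ xₛ ⊕ Q
      x-T = E²-cancel (xₛ ⊛ T ⊕ P) (xₛ ⊕ Q) λ n → begin
        ((xₛ ⊛ T ⊕ P) ⊛ (E ⊛ E) ⊕ (xₛ ⊕ Q)) n
          ≡⟨ S-Solver.solve 5 (λ x t p q e → (x S:* t S:+ p) S:* (e S:* e) S:+ (x S:+ q)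
               S:= (p S:* e) S:* e S:+ (x S:* (t S:* (e S:* e)) S:+ x S:+ q)) (λ _ → refl) xₛ T P Q E n ⟩
        ((P ⊛ E) ⊛ E ⊕ (xₛ ⊛ (T ⊛ (E ⊛ E)) ⊕ xₛ ⊕ Q)) n
          ≡⟨ cong (_+ (xₛ ⊛ (T ⊛ (E ⊛ E)) ⊕ xₛ ⊕ Q) n) (⊛-cong {g = E} P-E (λ _ → refl) n) ⟩
        ((P ⊕ (xₛ ⊕ xₛ)) ⊛ E ⊕ (xₛ ⊛ (T ⊛ (E ⊛ E)) ⊕ xₛ ⊕ Q)) n
          ≡⟨ S-Solver.solve 5 (λ x t p q e → (p S:+ (x S:+ x)) S:* e S:+ (x S:* (t S:* (e S:* e)) S:+ x S:+ q)
               S:= p S:* e S:+ (x S:* (t S:* (e S:* e) S:+ e S:+ e) S:+ x S:+ q)) (λ _ → refl) xₛ T P Q E n ⟩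
        (P ⊛ E ⊕ (xₛ ⊛ (T ⊛ (E ⊛ E) ⊕ E ⊕ E) ⊕ xₛ ⊕ Q)) n
          ≡⟨ cong₂ (λ y z → y + (z + xₛ n + Q n)) (P-E n) (⊛-cong {f = xₛ} (λ _ → refl) T-E² n) ⟩
        (P ⊕ (xₛ ⊕ xₛ) ⊕ (xₛ ⊛ (E ⊛ E ⊕ T ⊕ 1ₛ) ⊕ xₛ ⊕ Q)) n
          ≡⟨ S-Solver.solve 5 (λ x t p q e → p S:+ (x S:+ x) S:+
              (x S:* (e S:* e S:+ t S:+ S-Solver.con 1) S:+ x S:+ q)
               S:= (q S:+ ((x S:+ x) S:+ (x S:+ x))) S:+ (x S:* (e S:* e) S:+ (x S:* t S:+ p))) (λ _ →
                   refl) xₛ T P Q E n ⟩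
        (Q ⊕ ((xₛ ⊕ xₛ) ⊕ (xₛ ⊕ xₛ)) ⊕ (xₛ ⊛ (E ⊛ E) ⊕ (xₛ ⊛ T ⊕ P))) n
          ≡⟨ cong (_+ (xₛ ⊛ (E ⊛ E) ⊕ (xₛ ⊛ T ⊕ P)) n) (Q-E² n) ⟨
        (Q ⊛ (E ⊛ E) ⊕ (xₛ ⊛ (E ⊛ E) ⊕ (xₛ ⊛ T ⊕ P))) n
          ≡⟨ S-Solver.solve 5 (λ x t p q e → q S:* (e S:* e) S:+ (x S:* (e S:* e) S:+ (x S:* t S:+ p))
               S:= (x S:+ q) S:* (e S:* e) S:+ (x S:* t S:+ p)) (λ _ → refl) xₛ T P Q E n ⟩
        ((xₛ ⊕ Q) ⊛ (E ⊛ E) ⊕ (xₛ ⊛ T ⊕ P)) n ∎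

      tanh-bernoulli : ∀ n → ι (suc n) * T n + ι (2 ℕ.^ suc n) * B (suc n) ≡
                             1ₛ n + ι (2 ℕ.^ suc n) * (ι (2 ℕ.^ suc n) * B (suc n))
      tanh-bernoulli n = trans (cong (_+ P (suc n)) (sym (xₛ-⊛ T n))) (x-T (suc n))

  -- Multiplication by the exponential as a binomial sum

  Σlist-upTo-suc : ∀ n (F : ℕ → A) → Σlist (upTo (suc n)) F ≡ Σlist (upTo n) F + F n
  Σlist-upTo-suc n F = trans (cong (λ xs → Σlist xs F) (sym (upTo-∷ʳ n)))
    (trans (Σlist-++ (upTo n) [ n ] F) (cong (Σlist (upTo n) F +_) (+-identityʳ (F n))))

  Σlist-upTo-shift : ∀ n (F : ℕ → A) → Σlist (upTo (suc n)) F ≡ F 0 + Σlist (upTo n) (F ∘ suc)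
  Σlist-upTo-shift n F = cong (F 0 +_) (trans (cong (λ xs → Σlist xs F) (sym (map-upTo suc n)))
      (Σlist-map suc (upTo n) F))

  Σlist-+ : ∀ {B : Set} (xs : List B) F G → Σlist xs (λ x → F x + G x) ≡ Σlist xs F + Σlist xs G
  Σlist-+ []       F G = sym (+-identityˡ 0#)
  Σlist-+ (x ∷ xs) F G = trans (cong (F x + G x +_) (Σlist-+ xs F G)) (+-interchange _ _ _ _)

  -- Brings the product into the form of the Bernoulli recurrence; the two halves of the Leibniz
  -- rule combine by Pascal's rule.
  ⊛-exp : ∀ f n → (f ⊛ exp) n ≡ Σlist (upTo (suc n)) (λ j → ι (n C j) * f j)
  ⊛-exp f zero    = trans (*-comm (f 0) 1#) (trans (cong (_* f 0) (sym (+-identityʳ 1#))) (sym (+-identityʳ _)))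
  ⊛-exp f (suc n) = begin
    (f ∘ suc ⊛ exp) n + (f ⊛ exp) n
      ≡⟨ cong₂ _+_ (⊛-exp (f ∘ suc) n) (⊛-exp f n) ⟩
    Σlist (upTo (suc n)) (λ j → ι (n C j) * f (suc j)) + Σlist (upTo (suc n)) (λ j → ι (n C j) * f j)
      ≡⟨ cong (Σlist (upTo (suc n)) (λ j → ι (n C j) * f (suc j)) +_) drop-last ⟩
    Σlist (upTo (suc n)) (λ j → ι (n C j) * f (suc j)) + Σlist (upTo (suc (suc n))) (λ j → ι (n C j) * f j)
      ≡⟨ cong₂ _+_ refl (Σlist-upTo-shift (suc n) (λ j → ι (n C j) * f j)) ⟩
    Σlist (upTo (suc n)) (λ j → ι (n C j) * f (suc j)) +
        (ι 1 * f 0 + Σlist (upTo (suc n)) (λ j → ι (n C suc j) * f (suc j)))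
      ≡⟨ rotate _ _ _ ⟩
    ι 1 * f 0 + (Σlist (upTo (suc n)) (λ j → ι (n C j) * f (suc j)) +
        Σlist (upTo (suc n)) (λ j → ι (n C suc j) * f (suc j)))
      ≡⟨ cong (ι 1 * f 0 +_) (trans (sym (Σlist-+ (upTo (suc n)) _ _)) (Σlist-cong (upTo (suc n)) pascal)) ⟩
    ι 1 * f 0 + Σlist (upTo (suc n)) (λ j → ι (suc n C suc j) * f (suc j))
      ≡⟨ Σlist-upTo-shift (suc n) (λ j → ι (suc n C j) * f j) ⟨
    Σlist (upTo (suc (suc n))) (λ j → ι (suc n C j) * f j) ∎
    where
    rotate : ∀ a b c → a + (b + c) ≡ b + (a + c)
    rotate = solve 3 (λ a b c → a :+ (b :+ c) := b :+ (a :+ c)) refl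
    drop-last : Σlist (upTo (suc n)) (λ j → ι (n C j) * f j) ≡ Σlist (upTo (suc (suc n))) (λ j → ι (n C j) * f j)
    drop-last = sym (trans (Σlist-upTo-suc (suc n) (λ j → ι (n C j) * f j))
        (trans (cong (Σlist (upTo (suc n)) (λ j → ι (n C j) * f j) +_)
      (trans (cong (λ k → ι k * f (suc n)) (k>n⇒nCk≡0 {n} (ℕ.n<1+n n))) (zeroˡ _))) (+-identityʳ _)))
    pascal : ∀ j → ι (n C j) * f (suc j) + ι (n C suc j) * f (suc j) ≡ ι (suc n C suc j) * f (suc j)
    pascal j = trans (sym (distribʳ _ _ _))
        (cong (_* f (suc j)) (trans (sym (ι-+ (n C j) (n C suc j))) (cong ι (nCk+nC[k+1]≡[n+1]C[k+1] n j))))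

  -- The count of permutations as a sum over arrangements

  hasShape : ℕ → List ℕ → List ℕ → Bool
  hasShape n ps w = ⌊ ≡-dec ℕ._≟_ (rp n (hat w)) ps ⌋

  ι-countRP : ∀ n ps → ι (countRP n ps) ≡
    Σperm (downFrom (2 ℕ.* n)) (λ w → ⟦ altDown w ⟧ * ⟦ hasShape n ps w ⟧)
  ι-countRP n ps = begin
    ι (countRP n ps)
      ≡⟨ Σlist-filter (λ w → isAlternatingPerm m w ∧ hasShape n ps w) (words m m) ⟩
    Σlist (words m m) (λ w → ⟦ isAlternatingPerm m w ∧ hasShape n ps w ⟧)
      -- The alphabet is reversed so that its maximum becomes the head.
      ≡⟨ trans (Σlist-words m m _) (Σword-↭ m _
          (↭-trans (↭-sym (↭-reverse (upTo m))) (↭-reflexive (reverse-upTo m)))) ⟩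
    Σword m (downFrom m) (λ w → ⟦ isAlternatingPerm m w ∧ hasShape n ps w ⟧)
      ≡⟨ Σword-cong m (downFrom m) indicator ⟩
    Σword m (downFrom m) (λ w → ⟦ distinct w ⟧ * (⟦ altDown w ⟧ * ⟦ hasShape n ps w ⟧))
      ≡⟨ Σword-distinct m _ (downFrom⁺ m) ⟩
    Σarr m (downFrom m) (λ w → ⟦ altDown w ⟧ * ⟦ hasShape n ps w ⟧)
      ≡⟨ cong (λ k → Σarr k (downFrom m) (λ w → ⟦ altDown w ⟧ * ⟦ hasShape n ps w ⟧)) (length-downFrom m) ⟨
    Σperm (downFrom m) (λ w → ⟦ altDown w ⟧ * ⟦ hasShape n ps w ⟧) ∎
    where
    m = 2 ℕ.* n
    indicator : ∀ w → length w ≡ m → ⟦ isAlternatingPerm m w ∧ hasShape n ps w ⟧ ≡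
      ⟦ distinct w ⟧ * (⟦ altDown w ⟧ * ⟦ hasShape n ps w ⟧)
    indicator w l with length w ℕ.≟ m
    ... | yes _ = trans (⟦⟧-∧ (distinct w ∧ altDown w) _)
        (trans (cong (_* ⟦ hasShape n ps w ⟧) (⟦⟧-∧ (distinct w) (altDown w))) (*-assoc _ _ _))
    ... | no ¬l = contradiction l ¬l

  -- The factor ∏ mₖ! passes to the count with distinguished parts, where the closed form applies;
  -- keeping it on the left avoids division in `A`.
  countRP-formula : (x : ℕ → A) → (∀ c → c ≥ 1 → x c * ι ((2 ℕ.* c) !) ≡ e (pred (2 ℕ.* c))) →
    ∀ n ps → IsPartition n ps → factorials (parts n) ps * ι (countRP n ps) ≡ ι ((2 ℕ.* n) !) * Πlist ps x
  countRP-formula x x-def n ps partition@(ps↓ , ps≥1 , sum≡n) = begin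
    F * ι (countRP n ps)
      ≡⟨ cong (F *_) (ι-countRP n ps) ⟩
    F * Σperm V (λ w → ⟦ altDown w ⟧ * ⟦ hasShape n ps w ⟧)
      ≡⟨ Σarr-* F (length V) V _ ⟨
    Σperm V (λ w → F * (⟦ altDown w ⟧ * ⟦ hasShape n ps w ⟧))
      ≡⟨ Σperm-cong V label ⟩
    recordCount ps V
      ≡⟨ ClosedForm.recordCount-formula x x-def ps V ps≥1 (descending-downFrom m)
          (trans (cong even |V|) (even-2* n)) ⟩
    x^ (2 ℕ.* sum ps) (length V) * Πlist ps x
      ≡⟨ cong (_* Πlist ps x) (trans (cong₂ x^ (cong (2 ℕ.*_) sum≡n) |V|) (x^-diag m)) ⟩
    ι (m !) * Πlist ps x ∎
    where
    m = 2 ℕ.* n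
    V = downFrom m
    |V| = length-downFrom m
    F = factorials (parts n) ps
    exchange : ∀ a b c → a * (b * c) ≡ b * (a * c)
    exchange = solve 3 (λ a b c → a :* (b :* c) := b :* (a :* c)) refl
    label : ∀ w → w ↭ V → F * (⟦ altDown w ⟧ * ⟦ hasShape n ps w ⟧) ≡ ⟦ altDown w ⟧ *
        orderings ps (reverse (gapsOf w))
    label w p = trans (exchange _ _ _) (cong (⟦ altDown w ⟧ *_) (sym (trans
      (orderings-reverse ps (gapsOf w) (parts-unique n) (partition-∈-parts partition) ps↓)
      (cong (λ k → F * ⟦ ⌊ ≡-dec ℕ._≟_ (sortDesc (gaps k (rec (hat w)))) ps ⌋ ⟧)
        (trans (cong ⌊_/2⌋ (trans (↭-length p) |V|)) (⌊2*/2⌋ n))))))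

-- Rational numbers

import Data.Integer as ℤ
import Data.Integer.Properties as ℤ
open import Data.Rational as ℚ using (_+_; _*_; -_; toℚᵘ)
open import Data.Rational.Properties
open import Data.Rational.Solver using (module +-*-Solver)
import Data.Rational.Unnormalised as ℚᵘ
import Data.Rational.Unnormalised.Properties as ℚᵘ

toℚᵘ-/1 : ∀ k → toℚᵘ (fromℕ k) ℚᵘ.≃ ℚᵘ.mkℚᵘ (ℤ.+ k) 0
toℚᵘ-/1 k = toℚᵘ-fromℚᵘ (ℚᵘ.mkℚᵘ (ℤ.+ k) 0)

fromℕ-+ : ∀ a b → fromℕ (a ℕ.+ b) ≡ fromℕ a + fromℕ b
fromℕ-+ a b = toℚᵘ-injective (begin
  toℚᵘ (fromℕ (a ℕ.+ b))                     ≈⟨ toℚᵘ-/1 (a ℕ.+ b) ⟩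
  ℚᵘ.mkℚᵘ (ℤ.+ (a ℕ.+ b)) 0
      ≈⟨ ℚᵘ.*≡* (cong (ℤ._* ℤ.+ 1) (sym (cong₂ ℤ._+_ (ℤ.*-identityʳ (ℤ.+ a)) (ℤ.*-identityʳ (ℤ.+ b))))) ⟩
  ℚᵘ.mkℚᵘ (ℤ.+ a) 0 ℚᵘ.+ ℚᵘ.mkℚᵘ (ℤ.+ b) 0       ≈⟨ ℚᵘ.+-cong (toℚᵘ-/1 a) (toℚᵘ-/1 b) ⟨
  toℚᵘ (fromℕ a) ℚᵘ.+ toℚᵘ (fromℕ b)         ≈⟨ toℚᵘ-homo-+ (fromℕ a) (fromℕ b) ⟨
  toℚᵘ (fromℕ a + fromℕ b)                   ∎)
  where open ℚᵘ.≃-Reasoning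

fromℕ-suc : ∀ a → fromℕ (suc a) ≡ 1ℚ + fromℕ a
fromℕ-suc = fromℕ-+ 1

fromℕ-inverse : ∀ d .{{_ : ℕ.NonZero d}} → fromℕ d * invℕ d ≡ 1ℚ
fromℕ-inverse (suc d) = toℚᵘ-injective (begin
  toℚᵘ (fromℕ (suc d) * invℕ (suc d))                ≈⟨ toℚᵘ-homo-* (fromℕ (suc d)) (invℕ (suc d)) ⟩
  toℚᵘ (fromℕ (suc d)) ℚᵘ.* toℚᵘ (invℕ (suc d))      ≈⟨ ℚᵘ.*-cong (toℚᵘ-/1 (suc d))
      (toℚᵘ-fromℚᵘ (ℚᵘ.mkℚᵘ (ℤ.+ 1) d)) ⟩
  ℚᵘ.mkℚᵘ (ℤ.+ suc d) 0 ℚᵘ.* ℚᵘ.mkℚᵘ (ℤ.+ 1) d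
      ≈⟨ ℚᵘ.*≡* (trans (ℤ.*-identityʳ _)
      (trans (ℤ.*-identityʳ _) (sym (trans (ℤ.*-identityˡ _) (cong (λ z → ℤ.+ suc z) (ℕ.+-identityʳ d)))))) ⟩
  toℚᵘ 1ℚ                                            ∎)
  where open ℚᵘ.≃-Reasoning

0≤fromℕ : ∀ k → 0ℚ ℚ.≤ fromℕ k
0≤fromℕ k = nonNegative⁻¹ (fromℕ k) {{normalize-nonNeg k 1}}

0≤invℕ : ∀ d → 0ℚ ℚ.≤ invℕ d
0≤invℕ zero    = ≤-refl
0≤invℕ (suc d) = nonNegative⁻¹ (invℕ (suc d)) {{normalize-nonNeg 1 (suc d)}}

0≤+ : ∀ {p q} → 0ℚ ℚ.≤ p → 0ℚ ℚ.≤ q → 0ℚ ℚ.≤ p + q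
0≤+ = +-mono-≤

open Counting (IsCommutativeRing.isCommutativeSemiring +-*-isCommutativeRing) hiding (_+_; _*_)
open ≡-Reasoning
open +-*-Solver using (solve; _:=_; _:+_; _:*_; :-_; con)

ι≡fromℕ : ∀ n → ι n ≡ fromℕ n
ι≡fromℕ zero    = refl
ι≡fromℕ (suc n) = trans (cong (1ℚ +_) (ι≡fromℕ n)) (sym (fromℕ-suc n))

ι-inverse : ∀ d .{{_ : ℕ.NonZero d}} → ι d * invℕ d ≡ 1ℚ
ι-inverse d = trans (cong (_* invℕ d) (ι≡fromℕ d)) (fromℕ-inverse d)

+ℚ-cancelʳ : ∀ a {b c} → b + a ≡ c + a → b ≡ c
+ℚ-cancelʳ a {b} {c} eq = trans (add-sub b a) (trans (cong (_+ - a) eq) (sym (add-sub c a)))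
  where
  add-sub : ∀ b a → b ≡ b + a + - a
  add-sub = solve 2 (λ b a → b := b :+ a :+ :- a) refl

ι-cancelˡ : ∀ n {a b} → ι (suc n) * a ≡ ι (suc n) * b → a ≡ b
ι-cancelˡ n {a} {b} eq = trans (divide a) (trans (cong (invℕ (suc n) *_) eq) (sym (divide b)))
  where
  divide : ∀ a → a ≡ invℕ (suc n) * (ι (suc n) * a)
  divide a = begin
    a                                ≡⟨ *-identityˡ a ⟨
    1ℚ * a                           ≡⟨ cong (_* a) (ι-inverse (suc n)) ⟨
    ι (suc n) * invℕ (suc n) * a     ≡⟨ cong (_* a) (*-comm (ι (suc n)) (invℕ (suc n))) ⟩
    invℕ (suc n) * ι (suc n) * a     ≡⟨ *-assoc (invℕ (suc n)) (ι (suc n)) a ⟩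
    invℕ (suc n) * (ι (suc n) * a)   ∎

open WithCancellation +ℚ-cancelʳ ι-cancelˡ

-- Bernoulli numbers and the signed tangent numbers

lastQ-∷ʳ : ∀ xs x → lastQ (xs ++ [ x ]) ≡ x
lastQ-∷ʳ []           x = refl
lastQ-∷ʳ (y ∷ [])     x = refl
lastQ-∷ʳ (y ∷ z ∷ xs) x = lastQ-∷ʳ (z ∷ xs) x

bernList≡map : ∀ m → bernList m ≡ map bernoulli (upTo (suc m))
bernList≡map zero    = refl
bernList≡map (suc m) = trans (cong₂ (λ xs x → xs ++ [ x ]) (bernList≡map m) (sym (lastQ-∷ʳ (bernList m) _)))
  (trans (sym (map-++ bernoulli (upTo (suc m)) [ suc m ])) (cong (map bernoulli) (upTo-∷ʳ (suc m))))

sumQ-zip : ∀ (h : ℕ × ℚ → ℚ) (B : ℕ → ℚ) xs → sumQ (map h (zip xs (map B xs))) ≡ Σlist xs (λ j → h (j , B j))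
sumQ-zip h B []       = refl
sumQ-zip h B (x ∷ xs) = cong (h (x , B x) +_) (sumQ-zip h B xs)

binomialTerm : ℕ → ℕ → ℚ
binomialTerm n j = fromℕ (n C j) * bernoulli j

bernoulli-suc : ∀ m → bernoulli (suc m) ≡ - (invℕ (suc (suc m)) * Σlist (upTo (suc m)) (binomialTerm (suc (suc m))))
bernoulli-suc m = trans (lastQ-∷ʳ (bernList m) _) (cong (λ s → - (invℕ (suc (suc m)) * s))
  (trans (cong (λ bs → sumQ (map term (zip (upTo (suc m)) bs))) (bernList≡map m))
      (sumQ-zip term bernoulli (upTo (suc m)))))
  where
  term : ℕ × ℚ → ℚ
  term p = fromℕ (suc (suc m) C proj₁ p) * proj₂ p

-- For n ≥ 2 the definition of B_(n-1) makes the binomial sum over j < n vanish, which leaves B_n.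
-- The term x accounts for n = 1.
bernoulli-exp : bernoulli ⊛ exp ≗ bernoulli ⊕ xₛ
bernoulli-exp zero          = refl
bernoulli-exp (suc zero)    = refl
bernoulli-exp (suc (suc m)) = begin
  (bernoulli ⊛ exp) n
    ≡⟨ trans (⊛-exp bernoulli n) (Σlist-cong (upTo (suc n)) (λ j → cong (_* bernoulli j) (ι≡fromℕ (n C j)))) ⟩
  Σlist (upTo (suc n)) (binomialTerm n)
    ≡⟨ trans (Σlist-upTo-suc n (binomialTerm n))
        (cong (_+ binomialTerm n n) (Σlist-upTo-suc (suc m) (binomialTerm n))) ⟩
  S + fromℕ (n C suc m) * bernoulli (suc m) + fromℕ (n C n) * bernoulli n
    ≡⟨ cong₂ (λ p q → S + p + q)
         (cong₂ _*_ (trans (cong fromℕ nC[n-1]) (sym (ι≡fromℕ n))) (bernoulli-suc m))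
         (trans (cong (λ k → fromℕ k * bernoulli n) (nCn≡1 n)) (*-identityˡ (bernoulli n))) ⟩
  S + ι n * - (invℕ n * S) + bernoulli n
    ≡⟨ regroup S (ι n) (invℕ n) (bernoulli n) ⟩
  S + - (ι n * invℕ n * S) + bernoulli n
    ≡⟨ cong (λ z → S + - z + bernoulli n) (trans (cong (_* S) (ι-inverse n)) (*-identityˡ S)) ⟩
  S + - S + bernoulli n
    ≡⟨ trans (cong (_+ bernoulli n) (+-inverseʳ S)) (+-comm 0ℚ (bernoulli n)) ⟩
  bernoulli n + 0ℚ ∎
  where
  n = suc (suc m)
  S = Σlist (upTo (suc m)) (binomialTerm n)
  regroup : ∀ s n i b → s + n * - (i * s) + b ≡ s + - (n * i * s) + b
  regroup = solve 4 (λ s n i b → s :+ n :* :- (i :* s) :+ b := s :+ :- (n :* i :* s) :+ b) refl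
  nC[n-1] : n C suc m ≡ n
  nC[n-1] = trans (nCk≡nC[n∸k] (ℕ.n≤1+n (suc m))) (trans (cong (n C_) (ℕ.m+n∸n≡m 1 m)) (nC1≡n n))

-- The sign with which i turns the Taylor coefficients of tan into those of tanh.
sign : ℕ → ℚ
sign 0             = 1ℚ
sign 1             = 1ℚ
sign (suc (suc n)) = - sign n

tanh : Series
tanh n = ⟦ odd n ⟧ * sign n * e n

-- For odd i, i + j is even exactly when j is odd. Then (i + j)/2 = (i - 1)/2 + (j - 1)/2 + 1, and
-- the extra 1 is the minus sign that turns y′ = 1 + y² into t′ = 1 - t².
sign-+ : ∀ i j → ⟦ even (i ℕ.+ j) ⟧ * sign (suc (i ℕ.+ j)) * ⟦ odd i ⟧ ≡ - (⟦ odd i ⟧ * sign i * (⟦ odd j ⟧ * sign j))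
sign-+ 0 j = rearrange ⟦ even j ⟧ (sign (suc j)) (⟦ odd j ⟧ * sign j)
  where
  rearrange : ∀ a b c → a * b * 0ℚ ≡ - (0ℚ * 1ℚ * c)
  rearrange = solve 3 (λ a b c → a :* b :* con 0ℚ := :- (con 0ℚ :* con 1ℚ :* c)) refl
sign-+ 1 j = rearrange ⟦ odd j ⟧ (sign j)
  where
  rearrange : ∀ a b → a * - b * 1ℚ ≡ - (1ℚ * 1ℚ * (a * b))
  rearrange = solve 2 (λ a b → a :* :- b :* con 1ℚ := :- (con 1ℚ :* con 1ℚ :* (a :* b))) refl
sign-+ (suc (suc i)) j = begin
  a * - s * o                ≡⟨ solve 3 (λ a s o → a :* :- s :* o := :- (a :* s :* o)) refl a s o ⟩
  - (a * s * o)              ≡⟨ cong -_ (sign-+ i j) ⟩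
  - - (o * sign i * b)       ≡⟨ solve 3 (λ o s b → :- :- (o :* s :* b) := :- (o :* :- s :* b)) refl o (sign i) b ⟩
  - (o * - sign i * b)       ∎
  where
  a = ⟦ even (i ℕ.+ j) ⟧
  s = sign (suc (i ℕ.+ j))
  o = ⟦ odd i ⟧
  b = ⟦ odd j ⟧ * sign j

tanh-suc : tanh ∘ suc ⊕ tanh ⊛ tanh ≗ 1ₛ
tanh-suc n = begin
  c * e (suc n) + (tanh ⊛ tanh) n
    ≡⟨ cong (λ z → c * z + (tanh ⊛ tanh) n) (e-suc n) ⟩
  c * (s + 1ₛ n) + (tanh ⊛ tanh) n
    ≡⟨ solve 4 (λ c s o t → c :* (s :+ o) :+ t := (c :* s :+ t) :+ c :* o) refl c s (1ₛ n) ((tanh ⊛ tanh) n) ⟩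
  (c * s + (tanh ⊛ tanh) n) + c * 1ₛ n
    ≡⟨ cong₂ _+_ cancel (constant n) ⟩
  0ℚ + 1ₛ n
    ≡⟨ +-identityˡ (1ₛ n) ⟩
  1ₛ n ∎
  where
  c = ⟦ even n ⟧ * sign (suc n)
  s = shuffle (λ i j → ⟦ odd i ⟧ * (e i * e j)) n
  constant : ∀ n → ⟦ even n ⟧ * sign (suc n) * 1ₛ n ≡ 1ₛ n
  constant zero    = refl
  constant (suc n) = *-zeroʳ (⟦ odd n ⟧ * sign (suc (suc n)))
  term : ∀ i j → i ℕ.+ j ≡ n → c * (⟦ odd i ⟧ * (e i * e j)) + tanh i * tanh j ≡ 0ℚ
  term i j refl = begin
    c * (o * (e i * e j)) + o * sign i * e i * (o′ * sign j * e j)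
      ≡⟨ solve 7 (λ c o x y s o′ s′ → c :* (o :* (x :* y)) :+ o :* s :* x :* (o′ :* s′ :* y)
                   := (c :* o :+ o :* s :* (o′ :* s′)) :* (x :* y)) refl c o (e i) (e j) (sign i) o′ (sign j) ⟩
    (c * o + o * sign i * (o′ * sign j)) * (e i * e j)
      ≡⟨ cong (λ z → (z + o * sign i * (o′ * sign j)) * (e i * e j)) (sign-+ i j) ⟩
    (- (o * sign i * (o′ * sign j)) + o * sign i * (o′ * sign j)) * (e i * e j)
      ≡⟨ cong (_* (e i * e j)) (+-inverseˡ (o * sign i * (o′ * sign j))) ⟩
    0ℚ * (e i * e j)
      ≡⟨ *-zeroˡ (e i * e j) ⟩
    0ℚ ∎
    where
    o = ⟦ odd i ⟧
    o′ = ⟦ odd j ⟧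
  cancel : c * s + (tanh ⊛ tanh) n ≡ 0ℚ
  cancel = begin
    c * s + (tanh ⊛ tanh) n
      ≡⟨ cong (_+ (tanh ⊛ tanh) n) (shuffle-* c (λ i j → ⟦ odd i ⟧ * (e i * e j)) n) ⟨
    shuffle (λ i j → c * (⟦ odd i ⟧ * (e i * e j))) n + (tanh ⊛ tanh) n
      ≡⟨ shuffle-+ (λ i j → c * (⟦ odd i ⟧ * (e i * e j))) (λ i j → tanh i * tanh j) n ⟨
    shuffle (λ i j → c * (⟦ odd i ⟧ * (e i * e j)) + tanh i * tanh j) n
      ≡⟨ trans (shuffle-cong n term) (shuffle-0 n) ⟩
    0ℚ ∎

-- At exponent 2k the series b(4x) contributes 4^k 4^k B_(2k) and b(2x) contributes 4^k B_(2k),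
-- which explains the factor 4^k (4^k - 1).
coeff≡tanh : ∀ k → k ≥ 1 → coeff k ≡ tanh (pred (2 ℕ.* k)) * invℕ ((2 ℕ.* k) !)
coeff≡tanh (suc c) _ = begin
  fromℕ (4 ℕ.^ k) * fromℕ q * b * invℕ (2k ℕ.* 2k !)
    ≡⟨ cong (_* invℕ (2k ℕ.* 2k !)) main ⟨
  ι 2k * t * invℕ (2k ℕ.* 2k !)
    ≡⟨ cong (_* invℕ (2k ℕ.* 2k !)) (*-comm (ι 2k) t) ⟩
  t * ι 2k * invℕ (2k ℕ.* 2k !)
    ≡⟨ *-assoc t (ι 2k) (invℕ (2k ℕ.* 2k !)) ⟩
  t * (ι 2k * invℕ (2k ℕ.* 2k !))
    ≡⟨ cong (t *_) (cancel-factor (pred 2k) (2k !) {{ℕ._!≢0 2k}}) ⟩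
  t * invℕ (2k !) ∎
  where
  k = suc c
  2k = 2 ℕ.* k
  q = 4 ℕ.^ k ∸ 1
  b = bernoulli 2k
  t = tanh (pred 2k)
  cancel-factor : ∀ m d .{{_ : ℕ.NonZero d}} → ι (suc m) * invℕ (suc m ℕ.* d) ≡ invℕ d
  cancel-factor m d@(suc d-1) = ι-cancelˡ d-1 (begin
    ι d * (ι (suc m) * invℕ (suc m ℕ.* d))   ≡⟨ *-assoc (ι d) (ι (suc m)) (invℕ (suc m ℕ.* d)) ⟨
    ι d * ι (suc m) * invℕ (suc m ℕ.* d)
        ≡⟨ cong (_* invℕ (suc m ℕ.* d)) (trans (*-comm (ι d) (ι (suc m))) (sym (ι-* (suc m) d))) ⟩
    ι (suc m ℕ.* d) * invℕ (suc m ℕ.* d)     ≡⟨ ι-inverse (suc m ℕ.* d) ⟩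
    1ℚ                                       ≡⟨ ι-inverse d ⟨
    ι d * invℕ d                             ∎)
  2^2k : 2 ℕ.^ 2k ≡ 4 ℕ.^ k
  2^2k = sym (ℕ.^-*-assoc 2 2 k)
  4^k : ι (4 ℕ.^ k) ≡ 1ℚ + ι q
  4^k = cong ι (sym (ℕ.m+[n∸m]≡n {1} {4 ℕ.^ k} (ℕ.m^n>0 4 k)))
  -- The series x contributes only at exponent 1, whereas 2k ≥ 2.
  1ₛ-pred : 1ₛ (pred 2k) ≡ 0ℚ
  1ₛ-pred rewrite ℕ.+-suc c (c ℕ.+ 0) = refl
  main : ι 2k * t ≡ fromℕ (4 ℕ.^ k) * fromℕ q * b
  main = +ℚ-cancelʳ (ι (4 ℕ.^ k) * b) (begin
    ι 2k * t + ι (4 ℕ.^ k) * b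
      ≡⟨ cong (λ p → ι 2k * t + ι p * b) 2^2k ⟨
    ι 2k * t + ι (2 ℕ.^ 2k) * b
      ≡⟨ tanh-bernoulli tanh refl tanh-suc bernoulli bernoulli-exp (pred 2k) ⟩
    1ₛ (pred 2k) + ι (2 ℕ.^ 2k) * (ι (2 ℕ.^ 2k) * b)
      ≡⟨ cong₂ (λ z p → z + ι p * (ι p * b)) 1ₛ-pred 2^2k ⟩
    0ℚ + ι (4 ℕ.^ k) * (ι (4 ℕ.^ k) * b)
      ≡⟨ cong (λ z → 0ℚ + ι (4 ℕ.^ k) * (z * b)) 4^k ⟩
    0ℚ + ι (4 ℕ.^ k) * ((1ℚ + ι q) * b)
      ≡⟨ solve 3 (λ f q b → con 0ℚ :+ f :* ((con 1ℚ :+ q) :* b) := f :* q :* b :+ f :* b) refl (ι (4 ℕ.^ k)) (ι q) b ⟩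
    ι (4 ℕ.^ k) * ι q * b + ι (4 ℕ.^ k) * b
      ≡⟨ cong₂ (λ z y → z * y * b + ι (4 ℕ.^ k) * b) (ι≡fromℕ (4 ℕ.^ k)) (ι≡fromℕ q) ⟩
    fromℕ (4 ℕ.^ k) * fromℕ q * b + ι (4 ℕ.^ k) * b ∎)

-- Absolute values and the final comparison

∣sign∣ : ∀ n → ∣ sign n ∣ ≡ 1ℚ
∣sign∣ 0             = refl
∣sign∣ 1             = refl
∣sign∣ (suc (suc n)) = trans (∣-p∣≡∣p∣ (sign n)) (∣sign∣ n)

0≤Σsel : ∀ {B : Set} (V : List B) {K} → (∀ a V′ → 0ℚ ℚ.≤ K a V′) → 0ℚ ℚ.≤ Σsel V K
0≤Σsel []      0≤K = ≤-refl
0≤Σsel (x ∷ V) 0≤K = 0≤+ (0≤K x V) (0≤Σsel V λ a V′ → 0≤K a (x ∷ V′))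

0≤Σarr : ∀ {B : Set} k (V : List B) {F} → (∀ w → 0ℚ ℚ.≤ F w) → 0ℚ ℚ.≤ Σarr k V F
0≤Σarr zero    V 0≤F = 0≤F []
0≤Σarr (suc k) V 0≤F = 0≤Σsel V λ a V′ → 0≤Σarr k V′ λ w → 0≤F (a ∷ w)

0≤e : ∀ n → 0ℚ ℚ.≤ e n
0≤e n = 0≤Σarr (length (downFrom n)) (downFrom n) λ w → 0≤⟦⟧ (altUp w)
  where
  0≤⟦⟧ : ∀ b → 0ℚ ℚ.≤ ⟦ b ⟧
  0≤⟦⟧ true  = 0≤fromℕ 1
  0≤⟦⟧ false = ≤-refl

-- Serves as the `x` of `ClosedForm` and, for k ≥ 1, is the absolute value of `coeff k`.
weight : ℕ → ℚ
weight k = e (pred (2 ℕ.* k)) * invℕ ((2 ℕ.* k) !)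

odd-pred : ∀ c → odd (c ℕ.+ suc (c ℕ.+ 0)) ≡ true
odd-pred c rewrite ℕ.+-suc c (c ℕ.+ 0) = even-2* c

∣coeff∣ : ∀ k → k ≥ 1 → ∣ coeff k ∣ ≡ weight k
∣coeff∣ k@(suc c) k≥1 = begin
  ∣ coeff k ∣                                  ≡⟨ cong ∣_∣ (coeff≡tanh k k≥1) ⟩
  ∣ tanh n * i ∣
      ≡⟨ trans (∣p*q∣≡∣p∣*∣q∣ (tanh n) i) (cong₂ _*_ ∣tanh∣ (0≤p⇒∣p∣≡p (0≤invℕ ((2 ℕ.* k) !)))) ⟩
  e n * i                                      ∎
  where
  n = pred (2 ℕ.* k)
  i = invℕ ((2 ℕ.* k) !)
  ∣tanh∣ : ∣ tanh n ∣ ≡ e n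
  ∣tanh∣ = begin
    ∣ ⟦ odd n ⟧ * sign n * e n ∣     ≡⟨ cong (λ b → ∣ ⟦ b ⟧ * sign n * e n ∣) (odd-pred c) ⟩
    ∣ 1ℚ * sign n * e n ∣            ≡⟨ trans (∣p*q∣≡∣p∣*∣q∣ (1ℚ * sign n) (e n))
        (cong₂ _*_ (trans (cong ∣_∣ (*-identityˡ (sign n))) (∣sign∣ n)) (0≤p⇒∣p∣≡p (0≤e n))) ⟩
    1ℚ * e n                         ≡⟨ *-identityˡ (e n) ⟩
    e n                              ∎

∣^Q∣ : ∀ p m → ∣ p ^Q m ∣ ≡ ∣ p ∣ ^Q m
∣^Q∣ p zero    = refl
∣^Q∣ p (suc m) = trans (∣p*q∣≡∣p∣*∣q∣ p (p ^Q m)) (cong (∣ p ∣ *_) (∣^Q∣ p m))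

∣prodQ∣ : ∀ (f : ℕ → ℚ) ks → ∣ prodQ (map f ks) ∣ ≡ Πlist ks (∣_∣ ∘ f)
∣prodQ∣ f []       = refl
∣prodQ∣ f (k ∷ ks) = trans (∣p*q∣≡∣p∣*∣q∣ (f k) (prodQ (map f ks))) (cong (∣ f k ∣ *_) (∣prodQ∣ f ks))

inverses : ℕ → List ℕ → ℚ
inverses n ps = Πlist (parts n) (λ k → invℕ (mult k ps !))

Πlist-^Q : ∀ {n} x ps → All (_∈ parts n) ps → Πlist (parts n) (λ k → x k ^Q mult k ps) ≡ Πlist ps x
Πlist-^Q {n} x []       _             = Πlist-1 (parts n)
Πlist-^Q {n} x (c ∷ ps) (c∈ ∷ ps∈) = trans
  (Πlist-mult (λ k m → x k ^Q m) {y = x c} ps (parts-unique n) c∈ refl) (cong (x c *_) (Πlist-^Q x ps ps∈))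

-- Absolute value is multiplicative, so the signs disappear one factor at a time; the powers over
-- part sizes are then regrouped as a product over the entries of `ps`.
∣phi∣ : ∀ n ps → IsPartition n ps → ∣ phi n ps ∣ ≡ ι ((2 ℕ.* n) !) * (inverses n ps * Πlist ps weight)
∣phi∣ n ps partition = trans (∣p*q∣≡∣p∣*∣q∣ (fromℕ ((2 ℕ.* n) !)) _) (cong₂ _*_
  (trans (0≤p⇒∣p∣≡p (0≤fromℕ ((2 ℕ.* n) !))) (sym (ι≡fromℕ ((2 ℕ.* n) !))))
  (trans (∣prodQ∣ _ (parts n)) (trans (factors (upTo n)) (trans
    (Πlist-* (parts n) (λ k → invℕ (mult k ps !)) (λ k → weight k ^Q mult k ps))
    (cong (inverses n ps *_) (Πlist-^Q weight ps (partition-∈-parts partition)))))))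
  where
  ∣factor∣ : ∀ k → k ≥ 1 → ∣ invℕ (mult k ps !) * (coeff k ^Q mult k ps) ∣ ≡ invℕ (mult k ps !) *
      (weight k ^Q mult k ps)
  ∣factor∣ k k≥1 = trans (∣p*q∣≡∣p∣*∣q∣ (invℕ (mult k ps !)) (coeff k ^Q mult k ps)) (cong₂ _*_
    (0≤p⇒∣p∣≡p (0≤invℕ (mult k ps !)))
    (trans (∣^Q∣ (coeff k) (mult k ps)) (cong (_^Q mult k ps) (∣coeff∣ k k≥1))))
  factors : ∀ ks → Πlist (map suc ks) (λ k → ∣ invℕ (mult k ps !) * (coeff k ^Q mult k ps) ∣) ≡
    Πlist (map suc ks) (λ k → invℕ (mult k ps !) * (weight k ^Q mult k ps))
  factors []       = refl
  factors (k ∷ ks) = cong₂ _*_ (∣factor∣ (suc k) (ℕ.s≤s ℕ.z≤n)) (factors ks)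

weight-! : ∀ c → weight c * ι ((2 ℕ.* c) !) ≡ e (pred (2 ℕ.* c))
weight-! c = begin
  e n * invℕ f * ι f      ≡⟨ *-assoc (e n) (invℕ f) (ι f) ⟩
  e n * (invℕ f * ι f)    ≡⟨ cong (e n *_) (trans (*-comm (invℕ f) (ι f)) (ι-inverse f {{ℕ._!≢0 (2 ℕ.* c)}})) ⟩
  e n * 1ℚ                ≡⟨ *-identityʳ (e n) ⟩
  e n                     ∎
  where
  n = pred (2 ℕ.* c)
  f = (2 ℕ.* c) !

inverses-factorials : ∀ n ps → inverses n ps * factorials (parts n) ps ≡ 1ℚ
inverses-factorials n ps = begin
  inverses n ps * factorials (parts n) ps
    ≡⟨ Πlist-* (parts n) (λ k → invℕ (mult k ps !)) (λ k → ι (mult k ps !)) ⟨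
  Πlist (parts n) (λ k → invℕ (mult k ps !) * ι (mult k ps !))
    ≡⟨ Πlist-cong (parts n) (λ k → trans (*-comm (invℕ (mult k ps !)) (ι (mult k ps !)))
        (ι-inverse (mult k ps !) {{ℕ._!≢0 (mult k ps)}})) ⟩
  Πlist (parts n) (λ _ → 1ℚ)
    ≡⟨ Πlist-1 (parts n) ⟩
  1ℚ ∎

theorem3p2 : (n : ℕ) → 1 ≤ n → (λ′ : List ℕ) → IsPartition n λ′ →
    ∣ phi n λ′ ∣ ≡ fromℕ (countRP n λ′)
theorem3p2 n _ ps partition = begin
  ∣ phi n ps ∣
    ≡⟨ ∣phi∣ n ps partition ⟩
  N * (I * Πlist ps weight)
    ≡⟨ solve 3 (λ n i p → n :* (i :* p) := i :* (n :* p)) refl N I (Πlist ps weight) ⟩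
  I * (N * Πlist ps weight)
    ≡⟨ cong (I *_) (countRP-formula weight (λ c _ → weight-! c) n ps partition) ⟨
  I * (F * ι (countRP n ps))
    ≡⟨ *-assoc I F (ι (countRP n ps)) ⟨
  I * F * ι (countRP n ps)
    -- The factors 1/mₖ! of φ undo the distinction between equal parts.
    ≡⟨ cong (_* ι (countRP n ps)) (inverses-factorials n ps) ⟩
  1ℚ * ι (countRP n ps)
    ≡⟨ trans (*-identityˡ (ι (countRP n ps))) (ι≡fromℕ (countRP n ps)) ⟩
  fromℕ (countRP n ps) ∎
  where
  N = ι ((2 ℕ.* n) !)
  I = inverses n ps
  F = factorials (parts n) ps
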